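{- Fix $\alpha\in(0,1)$ and an integer $\lambda\ge0$. For the online time-critical task scheduling with calibration problem in which all jobs are $\alpha$-short window jobs (i.e., $d_j-r_j<\alpha T+\lambda$), with unit processing times and activation time $\lambda$, there exists an online algorithm with competitive ratio $(e+1)(\lambda+1)\lceil\frac{2}{1-\alpha}\rceil$.
   Context: Problem: unlimited identical machines; discrete time. A calibration started at integer time $t$ occupies $[t,t+\lambda+T)$, with activation interval $[t,t+\lambda)$ and calibrated interval $[t+\lambda,t+\lambda+T)$ ($T$ a positive integer). Machines process jobs only while calibrated, one job at a time. Each job $j$ has integer release time $r_j$, processing time $1$, integer deadline $d_j$ with $d_j-r_j\ge1+\lambda$; scheduling $j$ at integer time $\tau$ in a calibrated slot is feasible iff $r_j\le\tau$ and $\tau+1\le d_j$. Jobs arrive online (revealed at release time). Objective: minimize the number of calibrations while feasibly scheduling all jobs. An online algorithm is $c$-competitive if there is a constant $a$ with $ALG(Ins)\le c\cdot OPT(Ins)+a$ for every instance, where $OPT(Ins)$ is the minimum number of calibrations.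
   Formalization: The parameter α is taken rational instead of real in (0,1); the real case follows by replacing α with 1−2/⌈2/(1−α)⌉, which is rational, at least α, and has the same ceiling. -}

module Defs where

open import Data.Nat using (ℕ; zero; suc; _+_; _*_; _∸_; _≤_; _<_; _!)
open import Data.Nat.Properties using (_!≢0)
open import Data.Integer as ℤ using (ℤ; +_; +[1+_]; -[1+_])
open import Data.Rational as ℚ using (ℚ; mkℚ; _/_; _÷_; ceiling) renaming (_+_ to _+ℚ_; _-_ to _-ℚ_; _≤_ to _≤ℚ_)
open import Data.List using (List; []; length; lookup; map; upTo)
open import Data.Nat.ListAction using (sum)
open import Data.List.Relation.Unary.All using (All)
open import Data.List.Relation.Unary.Unique.Propositional using (Unique)
open import Data.List.Membership.Propositional using (_∈_)
open import Data.Vec using (Vec; tabulate)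
open import Data.Fin using (Fin; toℕ)
open import Data.Product using (Σ; ∃; _×_; _,_; proj₁; proj₂)
open import Relation.Binary.PropositionalEquality using (_≡_)
open import Function.Definitions using (Injective)

ℕ→ℚ : ℕ → ℚ
ℕ→ℚ n = + n / 1

ℤ→ℚ : ℤ → ℚ
ℤ→ℚ z = z / 1

-- ⌈ 2 / (1 - α) ⌉  (library division and ceiling; the value returned when
-- 1 - α = 0 is an irrelevant junk value, since the theorem assumes α < 1)
ceil2div1minus : ℚ → ℤ
ceil2div1minus α with 1ℚ' -ℚ α
  where 1ℚ' = + 1 / 1
... | q@(mkℚ +[1+ n ] _ _) = ceiling ((+ 2 / 1) ÷ q)
... | q@(mkℚ -[1+ n ] _ _) = ceiling ((+ 2 / 1) ÷ q)
... | mkℚ (+ zero) _ _     = + 0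

eSum : ℕ → ℚ
eSum zero    = + 1 / 1
eSum (suc n) = eSum n +ℚ ((+ 1 / (suc n !)) {{suc n !≢0}})

-- eUpper n = Σ_{k=0}^{n+1} 1/k! + 1/((n+1)·(n+1)!)  > e, and eUpper n ↓ e.
eUpper : ℕ → ℚ
eUpper n = eSum (suc n) +ℚ ((+ 1 / (suc n * suc n !)) {{nz}})
  where
  nz : Data.Nat.NonZero (suc n * suc n !)
  nz = Data.Nat.Properties.m*n≢0 (suc n) (suc n !) {{_}} {{suc n !≢0}}

-- "q > e" : q dominates one of the upper bounds eUpper n.
-- (The set of such q is exactly the open ray (e, ∞).)
AboveE : ℚ → Set
AboveE q = ∃ λ n → eUpper n ≤ℚ q

-- Instances.  Times are natural numbers.  arr t is the list of deadlines
-- of the jobs released at time t; job (t , i) is the i-th job released at t.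

record Instance : Set where
  field
    arr     : ℕ → List ℕ
    horizon : ℕ
    finite  : ∀ t → horizon ≤ t → arr t ≡ []
open Instance public

Job : Instance → Set
Job I = Σ ℕ λ s → Fin (length (arr I s))

release : (I : Instance) → Job I → ℕ
release I (s , i) = s

deadline : (I : Instance) → Job I → ℕ
deadline I (s , i) = lookup (arr I s) i

WellFormed : (lam : ℕ) → Instance → Set
WellFormed lam I = ∀ (j : Job I) → release I j + suc lam ≤ deadline I j

AlphaShort : (α : ℚ) (T lam : ℕ) → Instance → Set
AlphaShort α T lam I = ∀ (j : Job I) →
  ℕ→ℚ (deadline I j ∸ release I j) ℚ.< (α ℚ.* ℕ→ℚ T) +ℚ ℕ→ℚ lam

-- Offline schedules (unlimited machines).  A schedule is a list of
-- calibration start times and a placement of each job into a slot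
-- (calibration, integer time τ); at most one job per slot.

record Schedule (T lam : ℕ) (I : Instance) : Set where
  field
    cals  : List ℕ
    place : Job I → Fin (length cals) × ℕ
    inj   : Injective _≡_ _≡_ place
    rel   : ∀ j → release I j ≤ proj₂ (place j)
    dl    : ∀ j → suc (proj₂ (place j)) ≤ deadline I j
    calLo : ∀ j → lookup cals (proj₁ (place j)) + lam ≤ proj₂ (place j)
    calHi : ∀ j → proj₂ (place j) < lookup cals (proj₁ (place j)) + lam + T
open Schedule public

-- Online (deterministic) algorithms.
-- At time t the algorithm sees the history arr 0 , … , arr t (all jobs
-- released so far) and decides (a) how many calibrations to start at t and
-- (b) which jobs to process at t, on which calibrations.
-- A job id is (release time s , index i); a calibration id is
-- (start time u , k) meaning the k-th calibration started at time u.

JobId : Set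
JobId = ℕ × ℕ

CalId : Set
CalId = ℕ × ℕ

record Decision : Set where
  field
    calibs : ℕ
    runs   : List (JobId × CalId)
open Decision public

OnlineAlg : Set
OnlineAlg = (t : ℕ) → Vec (List ℕ) (suc t) → Decision

history : Instance → (t : ℕ) → Vec (List ℕ) (suc t)
history I t = tabulate (λ i → arr I (toℕ i))

dec : OnlineAlg → Instance → ℕ → Decision
dec A I t = A t (history I t)

CalibratedAt : (T lam : ℕ) → OnlineAlg → Instance → CalId → ℕ → Set
CalibratedAt T lam A I (u , k) t =
  (k < calibs (dec A I u)) × (u + lam ≤ t) × (t < u + lam + T)

LegalRun : (T lam : ℕ) → OnlineAlg → Instance → ℕ → JobId × CalId → Set
LegalRun T lam A I t ((s , i) , c) =
  Σ (i < length (arr I s)) λ _ →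
    (s ≤ t) × (∀ (j : Fin (length (arr I s))) → toℕ j ≡ i → suc t ≤ lookup (arr I s) j)
    × CalibratedAt T lam A I c t

Feasible : (T lam : ℕ) → OnlineAlg → Instance → Set
Feasible T lam A I =
  (∀ t → All (LegalRun T lam A I t) (runs (dec A I t)))
  × (∀ t → Unique (map proj₂ (runs (dec A I t))))
  × (∀ (j : Job I) → ∃ λ t → ∃ λ c → ((proj₁ j , toℕ (proj₂ j)) , c) ∈ runs (dec A I t))

algCalibs : OnlineAlg → Instance → ℕ → ℕ
algCalibs A I N = sum (map (λ t → calibs (dec A I t)) (upTo N))

{-# OPTIONS --safe #-}
module Submission where

-- Delay every job by lam: replacing each calibration of an offline schedule by lam + 1
-- copies, started 0, …, lam steps later, accommodates the delayed jobs, so this costs a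
-- factor lam + 1 and hides the activation time.
--
-- With k = ⌈2/(1-α)⌉ cut the release times into blocks of length L = ⌈2T/k⌉ and treat the
-- blocks separately.  All jobs of a block live in a window of length T, so a calibration
-- opened for the block lasts until its end; and a calibrated interval meets the windows
-- of at most k blocks.
--
-- Inside a block let m be the largest density ⌈#{jobs with window in [b,D)}/(D-b)⌉ of the
-- jobs seen so far, a lower bound on the number of calibrations meeting the block's window,
-- and run EDF on 3m machines.  If EDF missed a deadline D, then for some s the jobs due by
-- D and released in [s,D) would exceed the capacity of [s,D).  But at distance x from D,
-- m is at least 1/(3x) times the number of such jobs released at distance between x and 3x,
-- so ∑ m counts a job released at distance z with weight ∑_{z/3≤x≤z} 1/(3x), which is at
-- least 1/3 by the AM–HM inequality.  Finally 3 < e + 1.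

open import Defs
open import Data.List using (length)
open import Data.Nat using (ℕ; NonZero)
open import Data.Nat.Tactic.RingSolver using (solve-∀)
open import Data.Product using (Σ; _×_; _,_; proj₁; proj₂; ∃)
open import Relation.Binary.PropositionalEquality hiding (J)
open import Relation.Nullary.Negation using (contradiction)

module Sequences where

  open import Data.Fin using (toℕ)
  open import Data.Fin.Permutation using (reverse)
  open import Data.Fin.Properties using (opposite-prop; toℕ-fromℕ; toℕ-inject₁; toℕ<n)
  open import Data.List using (applyUpTo; map; upTo)
  open import Data.List.Properties using (map-upTo)
  open import Data.Nat
  open import Data.Nat.ListAction using () renaming (sum to sumList)
  open import Data.Nat.Properties
  open import Data.Sum using (inj₁; inj₂)
  open import Function using (_∘_)
  open import Relation.Nullary using (Dec; yes; no; ¬_)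
  open import Algebra.Properties.Semiring.Sum +-*-semiring as Fin using (sum)

  infixl 10 ∑
  syntax ∑ n (λ i → x) = ∑[ i < n ] x

  opaque
    ∑ : ℕ → (ℕ → ℕ) → ℕ
    ∑ n f = sum {n} (f ∘ toℕ)

    ∑-cong : ∀ n {f g} → (∀ i → i < n → f i ≡ g i) → ∑ n f ≡ ∑ n g
    ∑-cong n f≡g = Fin.sum-cong-≗ {n} λ i → f≡g (toℕ i) (toℕ<n i)

    ∑-zero : ∀ n {f} → (∀ i → i < n → f i ≡ 0) → ∑ n f ≡ 0
    ∑-zero n f≡0 = trans (∑-cong n f≡0) (Fin.sum-replicate-zero n)

    ∑-const : ∀ n c → ∑[ _ < n ] c ≡ n * c
    ∑-const zero    c = refl
    ∑-const (suc n) c = cong (c +_) (∑-const n c)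

    ∑-mono-≤ : ∀ n {f g} → (∀ i → i < n → f i ≤ g i) → ∑ n f ≤ ∑ n g
    ∑-mono-≤ zero    f≤g = z≤n
    ∑-mono-≤ (suc n) f≤g = +-mono-≤ (f≤g 0 z<s) (∑-mono-≤ n λ i i<n → f≤g (suc i) (s<s i<n))

    ∑-distrib-+ : ∀ n f g → ∑[ i < n ] (f i + g i) ≡ ∑ n f + ∑ n g
    ∑-distrib-+ n f g = Fin.∑-distrib-+ {n} (f ∘ toℕ) (g ∘ toℕ)

    *-distribˡ-∑ : ∀ c n f → c * ∑ n f ≡ ∑[ i < n ] (c * f i)
    *-distribˡ-∑ c n f = Fin.*-distribˡ-sum {n} c (f ∘ toℕ)

    *-distribʳ-∑ : ∀ c n f → ∑ n f * c ≡ ∑[ i < n ] (f i * c)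
    *-distribʳ-∑ c n f = Fin.*-distribʳ-sum {n} c (f ∘ toℕ)

    ∑-comm : ∀ m n (f : ℕ → ℕ → ℕ) → ∑[ i < m ] ∑[ j < n ] f i j ≡ ∑[ j < n ] ∑[ i < m ] f i j
    ∑-comm m n f = Fin.∑-comm {m} {n} λ i j → f (toℕ i) (toℕ j)

    ∑-reverse : ∀ n (f : ℕ → ℕ) → ∑[ i < n ] f (n ∸ suc i) ≡ ∑ n f
    ∑-reverse n f = sym (trans (Fin.sum-permute (f ∘ toℕ) (reverse {n}))
                               (Fin.sum-cong-≗ {n} (cong f ∘ opposite-prop)))

    ∑-last : ∀ n (f : ℕ → ℕ) → ∑ (suc n) f ≡ ∑ n f + f n
    ∑-last n f = trans (Fin.sum-init-last {n} (f ∘ toℕ))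
      (cong₂ _+_ (Fin.sum-cong-≗ {n} (cong f ∘ toℕ-inject₁)) (cong f (toℕ-fromℕ n)))

    ∑-split : ∀ m n (f : ℕ → ℕ) → ∑ (m + n) f ≡ ∑ m f + ∑[ i < n ] f (m + i)
    ∑-split zero    n f = refl
    ∑-split (suc m) n f = trans (cong (f 0 +_) (∑-split m n (f ∘ suc))) (sym (+-assoc (f 0) _ _))

    ∑-suc : ∀ n (f : ℕ → ℕ) → ∑ (suc n) f ≡ f 0 + ∑ n (f ∘ suc)
    ∑-suc n f = refl

    ∑-head : ∀ s n (f : ℕ → ℕ) → ∑[ i < suc n ] f (s + i) ≡ f s + ∑[ i < n ] f (suc s + i)
    ∑-head s n f = cong₂ _+_ (cong f (+-identityʳ s)) (∑-cong n λ i _ → cong f (+-suc s i))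

    ∑-monoˡ-≤ : ∀ f {m n} → m ≤ n → ∑ m f ≤ ∑ n f
    ∑-monoˡ-≤ f {m} m≤n with k , refl ← m≤n⇒∃[o]m+o≡n m≤n =
      ≤-trans (m≤m+n _ _) (≤-reflexive (sym (∑-split m k f)))

    ∑-segment-≤ : ∀ m n {k} (f : ℕ → ℕ) → m + n ≤ k → ∑[ i < n ] f (m + i) ≤ ∑ k f
    ∑-segment-≤ m n {k} f m+n≤k = begin
      ∑[ i < n ] f (m + i)           ≤⟨ m≤n+m _ _ ⟩
      ∑ m f + ∑[ i < n ] f (m + i)   ≡⟨ ∑-split m n f ⟨
      ∑ (m + n) f                    ≤⟨ ∑-monoˡ-≤ f m+n≤k ⟩
      ∑ k f                          ∎
      where open ≤-Reasoning

    ∑-truncate : ∀ m n (f : ℕ → ℕ) → (∀ i → n ≤ i → f i ≡ 0) → ∑ m f ≡ ∑ (m ⊓ n) f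
    ∑-truncate m n f f≡0 with ≤-total m n
    ... | inj₁ m≤n = cong (λ k → ∑ k f) (sym (m≤n⇒m⊓n≡m m≤n))
    ... | inj₂ n≤m with k , refl ← m≤n⇒∃[o]m+o≡n n≤m = begin
      ∑ (n + k) f                    ≡⟨ ∑-split n k f ⟩
      ∑ n f + ∑[ i < k ] f (n + i)   ≡⟨ cong (∑ n f +_) (∑-zero k λ i _ → f≡0 (n + i) (m≤m+n n i)) ⟩
      ∑ n f + 0                      ≡⟨ +-identityʳ _ ⟩
      ∑ n f                          ≡⟨ cong (λ k → ∑ k f) (m≥n⇒m⊓n≡n n≤m) ⟨
      ∑ ((n + k) ⊓ n) f              ∎
      where open ≡-Reasoning

    ∑-support : ∀ m n k (f : ℕ → ℕ) → (∀ i → i < m → f i ≡ 0) → (∀ i → m + k ≤ i → f i ≡ 0) →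
                ∑ (m + n) f ≡ ∑[ i < n ⊓ k ] f (m + i)
    ∑-support m n k f below above = begin
      ∑ (m + n) f                      ≡⟨ ∑-split m n f ⟩
      ∑ m f + ∑[ i < n ] f (m + i)     ≡⟨ cong (_+ ∑[ i < n ] f (m + i)) (∑-zero m below) ⟩
      ∑[ i < n ] f (m + i)             ≡⟨ ∑-truncate n k (λ i → f (m + i)) (λ i k≤i → above (m + i) (+-monoʳ-≤ m k≤i)) ⟩
      ∑[ i < n ⊓ k ] f (m + i)         ∎
      where open ≡-Reasoning

    ∑-blocks : ∀ n l (f : ℕ → ℕ) → ∑ (n * l) f ≡ ∑[ i < n ] ∑[ j < l ] f (i * l + j)
    ∑-blocks zero    l f = refl
    ∑-blocks (suc n) l f = begin
      ∑ (l + n * l) f                                             ≡⟨ ∑-split l (n * l) f ⟩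
      ∑ l f + ∑[ i < n * l ] f (l + i)                            ≡⟨ cong (∑ l f +_) (∑-blocks n l (f ∘ (l +_))) ⟩
      ∑ l f + ∑[ i < n ] ∑[ j < l ] f (l + (i * l + j))           ≡⟨ cong (∑ l f +_) (∑-cong n λ i _ → ∑-cong l λ j _ →
                                                                       cong f (+-assoc l (i * l) j)) ⟨
      ∑ l f + ∑[ i < n ] ∑[ j < l ] f (suc i * l + j)             ∎
      where open ≡-Reasoning

    sum-applyUpTo : ∀ f n → sumList (applyUpTo f n) ≡ ∑ n f
    sum-applyUpTo f zero    = refl
    sum-applyUpTo f (suc n) = cong (f 0 +_) (sum-applyUpTo (f ∘ suc) n)

    sum-map-upTo : ∀ (f : ℕ → ℕ) n → sumList (map f (upTo n)) ≡ ∑ n f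
    sum-map-upTo f n = trans (cong sumList (map-upTo f n)) (sum-applyUpTo f n)

  AgreeUpTo : {A : Set} → ℕ → (f g : ℕ → A) → Set
  AgreeUpTo n f g = ∀ i → i ≤ n → f i ≡ g i

  AgreeUpTo-≤ : ∀ {A : Set} {m n} {f g : ℕ → A} → m ≤ n → AgreeUpTo n f g → AgreeUpTo m f g
  AgreeUpTo-≤ m≤n f≡g i i≤m = f≡g i (≤-trans i≤m m≤n)

  increment : (ℕ → ℕ) → ℕ → ℕ
  increment f zero    = f 0
  increment f (suc i) = f (suc i) ∸ f i

  increment-cong : ∀ {f g n} → AgreeUpTo n f g → increment f n ≡ increment g n
  increment-cong {n = zero}  f≡g = f≡g 0 z≤n
  increment-cong {n = suc n} f≡g = cong₂ _∸_ (f≡g (suc n) ≤-refl) (f≡g n (n≤1+n n))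

  ∑-increment : ∀ {f} → (∀ i → f i ≤ f (suc i)) → ∀ n → ∑ (suc n) (increment f) ≡ f n
  ∑-increment {f} mono zero    = trans (∑-last 0 (increment f)) (cong (_+ f 0) (∑-zero 0 λ _ ()))
  ∑-increment {f} mono (suc n) = begin
    ∑ (suc (suc n)) (increment f)                    ≡⟨ ∑-last (suc n) (increment f) ⟩
    ∑ (suc n) (increment f) + (f (suc n) ∸ f n)      ≡⟨ cong (_+ (f (suc n) ∸ f n)) (∑-increment mono n) ⟩
    f n + (f (suc n) ∸ f n)                          ≡⟨ m+[n∸m]≡n (mono n) ⟩
    f (suc n)                                        ∎
    where open ≡-Reasoning

  indicator : ∀ {P : Set} → Dec P → ℕ
  indicator (yes _) = 1
  indicator (no _)  = 0

  indicator-true : ∀ {P : Set} (P? : Dec P) → P → indicator P? ≡ 1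
  indicator-true (yes _) p = refl
  indicator-true (no ¬p) p = contradiction p ¬p

  indicator-false : ∀ {P : Set} (P? : Dec P) → ¬ P → indicator P? ≡ 0
  indicator-false (yes p) ¬p = contradiction p ¬p
  indicator-false (no _)  ¬p = refl

  indicator-≤1 : ∀ {P : Set} (P? : Dec P) → indicator P? ≤ 1
  indicator-≤1 (yes _) = ≤-refl
  indicator-≤1 (no _)  = z≤n

module Division where

  open import Data.Nat
  open import Data.Nat.DivMod
  open import Data.Nat.Divisibility using (divides)
  open import Data.Nat.Properties
  open ≤-Reasoning

  [m/n]*n+m%n≡m : ∀ m n .{{_ : NonZero n}} → m / n * n + m % n ≡ m
  [m/n]*n+m%n≡m m n = trans (+-comm (m / n * n) (m % n)) (sym (m≡m%n+[m/n]*n m n))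

  [m*n+o]/n≡m : ∀ m {n o} .{{_ : NonZero n}} → o < n → (m * n + o) / n ≡ m
  [m*n+o]/n≡m m {n} {o} o<n = trans (+-distrib-/-∣ˡ {m * n} o (divides m refl))
    (trans (cong₂ _+_ (m*n/n≡m m n) (m<n⇒m/n≡0 o<n)) (+-identityʳ m))

  [m*n+o]%n≡o : ∀ m {n o} .{{_ : NonZero n}} → o < n → (m * n + o) % n ≡ o
  [m*n+o]%n≡o m {n} {o} o<n = trans (cong (_% n) (+-comm (m * n) o)) (trans ([m+kn]%n≡m%n o m n) (m<n⇒m%n≡m o<n))

  m<[1+m/n]*n : ∀ m n .{{_ : NonZero n}} → m < suc (m / n) * n
  m<[1+m/n]*n m n = begin-strict
    m                      ≡⟨ m≡m%n+[m/n]*n m n ⟩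
    m % n + m / n * n      <⟨ +-monoˡ-< (m / n * n) (m%n<n m n) ⟩
    suc (m / n) * n        ∎

  ⌈_/_⌉ : (m n : ℕ) .{{_ : NonZero n}} → ℕ
  ⌈ m / n ⌉ = (m + pred n) / n

  m≤⌈m/n⌉*n : ∀ m n .{{_ : NonZero n}} → m ≤ ⌈ m / n ⌉ * n
  m≤⌈m/n⌉*n m n@(suc n-1) = +-cancelʳ-≤ n-1 _ _ (begin
    m + n-1                             ≡⟨ m≡m%n+[m/n]*n (m + n-1) n ⟩
    (m + n-1) % n + ⌈ m / n ⌉ * n       ≤⟨ +-monoˡ-≤ _ (s≤s⁻¹ (m%n<n (m + n-1) n)) ⟩
    n-1 + ⌈ m / n ⌉ * n                 ≡⟨ +-comm n-1 _ ⟩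
    ⌈ m / n ⌉ * n + n-1                 ∎)

  m≤o*n⇒⌈m/n⌉≤o : ∀ m n o .{{_ : NonZero n}} → m ≤ o * n → ⌈ m / n ⌉ ≤ o
  m≤o*n⇒⌈m/n⌉≤o m n@(suc n-1) o m≤o*n = s≤s⁻¹ (m<n*o⇒m/o<n {n = suc o} (begin-strict
    m + n-1        <⟨ +-mono-≤-< m≤o*n (n<1+n n-1) ⟩
    o * n + n      ≡⟨ +-comm (o * n) n ⟩
    suc o * n      ∎))

module HarmonicDensity where

  open Division
  open Sequences
  open import Data.Nat
  open import Data.Nat.DivMod using (_/_; m*[n/m]≡n; m/n*n≤m)
  open import Data.Nat.Divisibility using (_∣_; ∣-trans; m∣m*n; m≤n⇒m!∣n!)
  open import Data.Nat.Properties
  open import Data.Sum using (inj₁; inj₂)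
  open import Algebra.Properties.CommutativeSemigroup +-commutativeSemigroup using (xy∙z≈x∙zy)
  open import Algebra.Properties.CommutativeSemigroup *-commutativeSemigroup using (x∙yz≈y∙xz)
  open import Function using (_∘_)
  open import Relation.Nullary using (Dec; ¬_)
  open import Relation.Nullary.Decidable using (_×-dec_)
  open ≤-Reasoning

  4m[m+d]≤[m+[m+d]]² : ∀ m d → 4 * (m * (m + d)) ≤ (m + (m + d)) * (m + (m + d))
  4m[m+d]≤[m+[m+d]]² m d = ≤-trans (m≤m+n _ (d * d)) (≤-reflexive (complete-square m d))
    where
    complete-square : ∀ m d → 4 * (m * (m + d)) + d * d ≡ (m + (m + d)) * (m + (m + d))
    complete-square = solve-∀

  4mn≤[m+n]² : ∀ m n → 4 * (m * n) ≤ (m + n) * (m + n)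
  4mn≤[m+n]² m n with ≤-total m n
  ... | inj₁ m≤n with d , refl ← m≤n⇒∃[o]m+o≡n m≤n = 4m[m+d]≤[m+[m+d]]² m d
  ... | inj₂ n≤m with d , refl ← m≤n⇒∃[o]m+o≡n n≤m rewrite *-comm (n + d) n | +-comm (n + d) n = 4m[m+d]≤[m+[m+d]]² n d

  mn≡o²⇒2o≤m+n : ∀ m n o → m * n ≡ o * o → 2 * o ≤ m + n
  mn≡o²⇒2o≤m+n m n o mn≡o² = ≮⇒≥ λ m+n<2o → <-irrefl refl (begin-strict
    (m + n) * (m + n)   <⟨ *-mono-< m+n<2o m+n<2o ⟩
    2 * o * (2 * o)     ≡⟨ double o ⟩
    4 * (o * o)         ≡⟨ cong (4 *_) mn≡o² ⟨
    4 * (m * n)         ≤⟨ 4mn≤[m+n]² m n ⟩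
    (m + n) * (m + n)   ∎)
    where
    double : ∀ o → 2 * o * (2 * o) ≡ 4 * (o * o)
    double = solve-∀

  mixed-terms-≥ : ∀ n P x₀ p₀ (x p : ℕ → ℕ) → x₀ * p₀ ≡ P → (∀ i → i < n → x i * p i ≡ P) →
                  n * (2 * P) ≤ x₀ * ∑ n p + ∑ n x * p₀
  mixed-terms-≥ n P x₀ p₀ x p x₀p₀≡P xp≡P = begin
    n * (2 * P)                                         ≡⟨ ∑-const n (2 * P) ⟨
    ∑[ _ < n ] (2 * P)                                  ≤⟨ ∑-mono-≤ n pair≥ ⟩
    ∑[ i < n ] (x₀ * p i + x i * p₀)                    ≡⟨ ∑-distrib-+ n _ _ ⟩
    ∑[ i < n ] (x₀ * p i) + ∑[ i < n ] (x i * p₀)       ≡⟨ cong₂ _+_ (*-distribˡ-∑ x₀ n p) (*-distribʳ-∑ p₀ n x) ⟨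
    x₀ * ∑ n p + ∑ n x * p₀                             ∎
    where
    regroup : ∀ a b c d → a * b * (c * d) ≡ a * d * (c * b)
    regroup = solve-∀
    pair≥ : ∀ i → i < n → 2 * P ≤ x₀ * p i + x i * p₀
    pair≥ i i<n = mn≡o²⇒2o≤m+n (x₀ * p i) (x i * p₀) P
      (trans (regroup x₀ (p i) (x i) p₀) (cong₂ _*_ x₀p₀≡P (xp≡P i i<n)))

  -- Cleared of denominators: p i stands for P / x i.
  AM-HM : ∀ n P (x p : ℕ → ℕ) → (∀ i → i < n → x i * p i ≡ P) → n * n * P ≤ ∑ n x * ∑ n p
  AM-HM zero    P x p xp≡P = z≤n
  AM-HM (suc n) P x p xp≡P = begin
    suc n * suc n * P                                      ≡⟨ expand n P ⟩
    P + n * (2 * P) + n * n * P                            ≤⟨ +-mono-≤ (+-monoʳ-≤ P mixed) (AM-HM n P x′ p′ xp′≡P) ⟩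
    P + cross + ∑ n x′ * ∑ n p′                            ≡⟨ cong (λ Q → Q + cross + ∑ n x′ * ∑ n p′) (xp≡P 0 z<s) ⟨
    x 0 * p 0 + cross + ∑ n x′ * ∑ n p′                    ≡⟨ factor (x 0) (p 0) (∑ n x′) (∑ n p′) ⟩
    (x 0 + ∑ n x′) * (p 0 + ∑ n p′)                        ≡⟨ cong₂ _*_ (∑-suc n x) (∑-suc n p) ⟨
    ∑ (suc n) x * ∑ (suc n) p                              ∎
    where
    x′ p′ : ℕ → ℕ
    x′ = x ∘ suc
    p′ = p ∘ suc
    xp′≡P : ∀ i → i < n → x′ i * p′ i ≡ P
    xp′≡P i i<n = xp≡P (suc i) (s<s i<n)
    cross : ℕ
    cross = x 0 * ∑ n p′ + ∑ n x′ * p 0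
    mixed : n * (2 * P) ≤ cross
    mixed = mixed-terms-≥ n P (x 0) (p 0) x′ p′ (xp≡P 0 z<s) xp′≡P
    expand : ∀ n P → suc n * suc n * P ≡ P + n * (2 * P) + n * n * P
    expand = solve-∀
    factor : ∀ a b c d → a * b + (a * d + c * b) + c * d ≡ (a + c) * (b + d)
    factor = solve-∀

  ∑[m+i]≤n² : ∀ m n → 2 * m ≤ suc n → ∑[ i < n ] (m + i) ≤ n * n
  ∑[m+i]≤n² m n 2m≤1+n = *-cancelˡ-≤ 2 (begin
    2 * ∑[ i < n ] (m + i)                                    ≡⟨ cong (∑[ i < n ] (m + i) +_) (+-identityʳ _) ⟩
    ∑[ i < n ] (m + i) + ∑[ i < n ] (m + i)                   ≡⟨ cong (∑[ i < n ] (m + i) +_) (∑-reverse n (m +_)) ⟨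
    ∑[ i < n ] (m + i) + ∑[ i < n ] (m + (n ∸ suc i))         ≡⟨ ∑-distrib-+ n _ _ ⟨
    ∑[ i < n ] (m + i + (m + (n ∸ suc i)))                    ≤⟨ ∑-mono-≤ n (λ i i<n → s≤s⁻¹ (pair≤ i i<n)) ⟩
    ∑[ _ < n ] (2 * n)                                        ≡⟨ ∑-const n (2 * n) ⟩
    n * (2 * n)                                               ≡⟨ x∙yz≈y∙xz n 2 n ⟩
    2 * (n * n)                                               ∎)
    where
    collect : ∀ m i j → suc (m + i + (m + j)) ≡ 2 * m + (suc i + j)
    collect = solve-∀
    pair≤ : ∀ i → i < n → suc (m + i + (m + (n ∸ suc i))) ≤ suc (2 * n)
    pair≤ i i<n = begin
      suc (m + i + (m + (n ∸ suc i)))    ≡⟨ collect m i (n ∸ suc i) ⟩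
      2 * m + (suc i + (n ∸ suc i))      ≡⟨ cong (2 * m +_) (m+[n∸m]≡n i<n) ⟩
      2 * m + n                          ≤⟨ +-monoˡ-≤ n 2m≤1+n ⟩
      suc (n + n)                        ≡⟨ cong (λ k → suc (n + k)) (+-identityʳ n) ⟨
      suc (2 * n)                        ∎

  -- 1/m + … + 1/(m+n-1) ≥ 1, multiplied by P.
  harmonic-segment : ∀ m n .{{_ : NonZero n}} P (p : ℕ → ℕ) → 2 * m ≤ suc n →
                     (∀ i → i < n → (m + i) * p i ≡ P) → P ≤ ∑ n p
  harmonic-segment m n P p 2m≤1+n eq = *-cancelˡ-≤ (n * n) {{m*n≢0 n n}} (begin
    n * n * P                      ≤⟨ AM-HM n P (m +_) p eq ⟩
    ∑[ i < n ] (m + i) * ∑ n p     ≤⟨ *-monoˡ-≤ (∑ n p) (∑[m+i]≤n² m n 2m≤1+n) ⟩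
    n * n * ∑ n p                  ∎)

  suc∣! : ∀ {m n} → m < n → suc m ∣ n !
  suc∣! {m} m<n = ∣-trans (m∣m*n (m !)) (m≤n⇒m!∣n! m<n)

  -- Positions are counted from 0: the window of distances [x + 1 , 3 (x + 1)] from a deadline
  -- contains z + 1.
  Covers : ℕ → ℕ → Set
  Covers x z = x ≤ z × z < 3 * suc x

  covers? : ∀ x z → Dec (Covers x z)
  covers? x z = (x ≤? z) ×-dec (z <? 3 * suc x)

  covering-weight : ∀ {k z} P (p : ℕ → ℕ) → (∀ x → x < k → suc x * p x ≡ P) → z < k →
                    P ≤ ∑[ x < k ] (p x * indicator (covers? x z))
  covering-weight {k} {z} P p xp≡P z<k = begin
    P                                                        ≤⟨ harmonic-segment (suc a) n P (λ i → p (a + i)) 2a≤1+n xp-segment ⟩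
    ∑[ i < n ] p (a + i)                                     ≡⟨ ∑-cong n covered ⟩
    ∑[ i < n ] (p (a + i) * indicator (covers? (a + i) z))   ≤⟨ ∑-segment-≤ a n (λ x → p x * indicator (covers? x z)) a+n≤k ⟩
    ∑[ x < k ] (p x * indicator (covers? x z))               ∎
    where
    a n : ℕ
    a = z / 3
    n = suc (z ∸ a)
    3a≤z : 3 * a ≤ z
    3a≤z = ≤-trans (≤-reflexive (*-comm 3 a)) (m/n*n≤m z 3)
    a+n≡1+z : a + n ≡ suc z
    a+n≡1+z = trans (+-suc a (z ∸ a)) (cong suc (m+[n∸m]≡n (≤-trans (m≤n*m a 3) 3a≤z)))
    a+n≤k : a + n ≤ k
    a+n≤k = ≤-trans (≤-reflexive a+n≡1+z) z<k
    2a≤1+n : 2 * suc a ≤ suc n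
    2a≤1+n = begin
      2 * suc a              ≡⟨ *-suc 2 a ⟩
      2 + 2 * a              ≡⟨ cong (2 +_) (m+n∸m≡n a (2 * a)) ⟨
      2 + (3 * a ∸ a)        ≤⟨ +-monoʳ-≤ 2 (∸-monoˡ-≤ a 3a≤z) ⟩
      suc n                  ∎
    xp-segment : ∀ i → i < n → suc (a + i) * p (a + i) ≡ P
    xp-segment i i<n = xp≡P (a + i) (<-≤-trans (+-monoʳ-< a i<n) a+n≤k)
    covers : ∀ i → i < n → Covers (a + i) z
    covers i i<n =
      s≤s⁻¹ (≤-trans (+-monoʳ-< a i<n) (≤-reflexive a+n≡1+z)) ,
      <-≤-trans (m<[1+m/n]*n z 3) (≤-trans (≤-reflexive (*-comm (suc a) 3)) (*-monoʳ-≤ 3 (s≤s (m≤m+n a i))))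
    covered : ∀ i → i < n → p (a + i) ≡ p (a + i) * indicator (covers? (a + i) z)
    covered i i<n = sym (trans (cong (p (a + i) *_) (indicator-true (covers? (a + i) z) (covers i i<n))) (*-identityʳ _))

  covered-mass : ∀ {k x} (n : ℕ → ℕ) μ → x < k →
    (∀ j → suc x + j ≤ k → ∑[ i < suc j ] n (x + i) ≤ μ * (suc x + j)) →
    ∑[ z < k ] (indicator (covers? x z) * n z) ≤ μ * (3 * suc x)
  covered-mass {k} {x} n μ x<k dense with r , refl ← m≤n⇒∃[o]m+o≡n x<k = begin
    ∑[ z < suc x + r ] f z                             ≡⟨ cong (λ k → ∑ k f) (+-suc x r) ⟨
    ∑[ z < x + suc r ] f z                             ≡⟨ ∑-support x (suc r) (3 + 2 * x) f below above ⟩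
    ∑[ i < suc j ] f (x + i)                           ≤⟨ ∑-mono-≤ (suc j) (λ i _ → f≤n (x + i)) ⟩
    ∑[ i < suc j ] n (x + i)                           ≤⟨ dense j (+-monoʳ-≤ (suc x) (m⊓n≤m r (2 + 2 * x))) ⟩
    μ * (suc x + j)                                    ≤⟨ *-monoʳ-≤ μ (+-monoʳ-≤ (suc x) (m⊓n≤n r (2 + 2 * x))) ⟩
    μ * (suc x + (2 + 2 * x))                          ≡⟨ cong (μ *_) (triple x) ⟩
    μ * (3 * suc x)                                    ∎
    where
    f : ℕ → ℕ
    f z = indicator (covers? x z) * n z
    j : ℕ
    j = r ⊓ (2 + 2 * x)
    triple : ∀ x → suc x + (2 + 2 * x) ≡ 3 * suc x
    triple = solve-∀
    uncovered : ∀ z → ¬ Covers x z → f z ≡ 0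
    uncovered z ¬covers = cong (_* n z) (indicator-false (covers? x z) ¬covers)
    below : ∀ z → z < x → f z ≡ 0
    below z z<x = uncovered z λ (x≤z , _) → <⇒≱ z<x x≤z
    above : ∀ z → x + (3 + 2 * x) ≤ z → f z ≡ 0
    above z end≤z = uncovered z λ (_ , z<end) → <⇒≱ z<end
      (≤-trans (≤-reflexive (trans (sym (triple x)) (sym (+-suc x (2 + 2 * x))))) end≤z)
    f≤n : ∀ z → f z ≤ n z
    f≤n z = ≤-trans (*-monoˡ-≤ (n z) (indicator-≤1 (covers? x z))) (≤-reflexive (*-identityˡ (n z)))

  total≤3∑density-fromEnd : ∀ k (n μ : ℕ → ℕ) →
    (∀ x j → suc x + j ≤ k → ∑[ i < suc j ] n (x + i) ≤ μ x * (suc x + j)) →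
    ∑ k n ≤ 3 * ∑ k μ
  total≤3∑density-fromEnd k n μ dense = *-cancelˡ-≤ P {{k !≢0}} (begin
    P * ∑ k n                                         ≡⟨ *-distribˡ-∑ P k n ⟩
    ∑[ z < k ] (P * n z)                              ≤⟨ ∑-mono-≤ k (λ z z<k → *-monoˡ-≤ (n z) (covering-weight P p p-spec z<k)) ⟩
    ∑[ z < k ] (∑[ x < k ] (p x * I x z) * n z)       ≡⟨ ∑-cong k (λ z _ → *-distribʳ-∑ (n z) k _) ⟩
    ∑[ z < k ] ∑[ x < k ] (p x * I x z * n z)         ≡⟨ ∑-comm k k (λ z x → p x * I x z * n z) ⟩
    ∑[ x < k ] ∑[ z < k ] (p x * I x z * n z)         ≡⟨ ∑-cong k (λ x _ → factor-out x) ⟩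
    ∑[ x < k ] (p x * ∑[ z < k ] (I x z * n z))       ≤⟨ ∑-mono-≤ k (λ x x<k → *-monoʳ-≤ (p x) (covered-mass n (μ x) x<k (dense x))) ⟩
    ∑[ x < k ] (p x * (μ x * (3 * suc x)))            ≡⟨ ∑-cong k cancel-weight ⟩
    ∑[ x < k ] (P * (3 * μ x))                        ≡⟨ *-distribˡ-∑ P k _ ⟨
    P * ∑[ x < k ] (3 * μ x)                          ≡⟨ cong (P *_) (*-distribˡ-∑ 3 k μ) ⟨
    P * (3 * ∑ k μ)                                   ∎)
    where
    P : ℕ
    P = k !
    p : ℕ → ℕ
    p x = P / suc x
    p-spec : ∀ x → x < k → suc x * p x ≡ P
    p-spec x x<k = m*[n/m]≡n (suc∣! x<k)
    I : ℕ → ℕ → ℕ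
    I x z = indicator (covers? x z)
    factor-out : ∀ x → ∑[ z < k ] (p x * I x z * n z) ≡ p x * ∑[ z < k ] (I x z * n z)
    factor-out x = trans (∑-cong k λ z _ → *-assoc (p x) (I x z) (n z)) (sym (*-distribˡ-∑ (p x) k _))
    regroup : ∀ a b c → a * (b * (3 * c)) ≡ c * a * (3 * b)
    regroup = solve-∀
    cancel-weight : ∀ x → x < k → p x * (μ x * (3 * suc x)) ≡ P * (3 * μ x)
    cancel-weight x x<k = trans (regroup (p x) (μ x) (suc x)) (cong (_* (3 * μ x)) (p-spec x x<k))

  total≤3∑density : ∀ k (f m : ℕ → ℕ) →
    (∀ b j l → b + suc j + l ≡ k → ∑[ i < suc j ] f (b + i) ≤ m (b + j) * suc (j + l)) →
    ∑ k f ≤ 3 * ∑ k m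
  total≤3∑density k f m dense = begin
    ∑ k f                              ≡⟨ ∑-reverse k f ⟨
    ∑[ z < k ] f (k ∸ suc z)           ≤⟨ total≤3∑density-fromEnd k _ _ reversed ⟩
    3 * ∑[ x < k ] m (k ∸ suc x)       ≡⟨ cong (3 *_) (∑-reverse k m) ⟩
    3 * ∑ k m                          ∎
    where
    reversed : ∀ x j → suc x + j ≤ k →
               ∑[ i < suc j ] f (k ∸ suc (x + i)) ≤ m (k ∸ suc x) * (suc x + j)
    reversed x j fits with b , refl ← m≤n⇒∃[o]m+o≡n fits = begin
      ∑[ i < suc j ] f (x + j + b ∸ (x + i))      ≡⟨ ∑-cong (suc j) (λ i i≤j → cong f (cancel i (s≤s⁻¹ i≤j))) ⟩
      ∑[ i < suc j ] f (b + (j ∸ i))              ≡⟨ ∑-reverse (suc j) (λ i → f (b + i)) ⟩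
      ∑[ i < suc j ] f (b + i)                    ≤⟨ dense b j x (regroup b j x) ⟩
      m (b + j) * suc (j + x)                     ≡⟨ cong₂ _*_ (cong m end) (cong suc (+-comm x j)) ⟨
      m (x + j + b ∸ x) * (suc x + j)             ∎
      where
      regroup : ∀ b j x → b + suc j + x ≡ suc x + j + b
      regroup = solve-∀
      cancel : ∀ i → i ≤ j → x + j + b ∸ (x + i) ≡ b + (j ∸ i)
      cancel i i≤j = trans (cong (_∸ (x + i)) (xy∙z≈x∙zy x j b))
        (trans ([m+n]∸[m+o]≡n∸o x (b + j) i) (+-∸-assoc b i≤j))
      end : x + j + b ∸ x ≡ b + j
      end = trans (cong (_∸ x) (xy∙z≈x∙zy x j b)) (m+n∸m≡n x (b + j))

module ListProperties where

  open Sequences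
  open import Data.List using (List; []; _∷_; _++_; cartesianProduct; concat; concatMap; drop; filter; map; take; zip)
  open import Data.List.Membership.Propositional using (_∈_)
  open import Data.List.Membership.Propositional.Properties using (∈-∃++)
  open import Data.List.Properties using (length-++; length-map; map-cong-local)
  open import Data.List.Relation.Binary.Permutation.Propositional.Properties using (↭-length; ∈-resp-↭; shift)
  open import Data.List.Relation.Binary.Sublist.Propositional.Properties using (Any-resp-⊆; drop-⊆; take-⊆)
  open import Data.List.Relation.Unary.All as All using ()
  import Data.List.Relation.Unary.All.Properties as All
  open import Data.List.Relation.Unary.AllPairs as AllPairs using ([]; _∷_)
  import Data.List.Relation.Unary.AllPairs.Properties as AllPairs
  open import Data.List.Relation.Unary.Any using (here; there)
  open import Data.List.Relation.Unary.Unique.Propositional using (Unique)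
  import Data.List.Relation.Unary.Unique.Propositional.Properties as Unique
  open import Data.Nat
  open import Data.Nat.ListAction using (sum)
  open import Data.Nat.Properties
  open import Data.Sum using (_⊎_; inj₁; inj₂)
  open import Function using (_∘_)
  open import Relation.Nullary using (Dec; yes; no)

  private variable
    A B : Set

  ∈-drop⁻ : ∀ n {x : A} {xs} → x ∈ drop n xs → x ∈ xs
  ∈-drop⁻ n = Any-resp-⊆ (drop-⊆ n _)

  ∈-take⁻ : ∀ n {x : A} {xs} → x ∈ take n xs → x ∈ xs
  ∈-take⁻ n = Any-resp-⊆ (take-⊆ n _)

  ∈-zip⁻ : ∀ (xs : List A) (ys : List B) {x y} → (x , y) ∈ zip xs ys → x ∈ xs × y ∈ ys
  ∈-zip⁻ (x ∷ xs) (y ∷ ys) (here refl) = here refl , here refl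
  ∈-zip⁻ (x ∷ xs) (y ∷ ys) (there xy∈) = let x∈ , y∈ = ∈-zip⁻ xs ys xy∈ in there x∈ , there y∈

  map-proj₂-zip : ∀ (xs : List A) (ys : List B) → map proj₂ (zip xs ys) ≡ take (length xs) ys
  map-proj₂-zip []       ys       = refl
  map-proj₂-zip (x ∷ xs) []       = refl
  map-proj₂-zip (x ∷ xs) (y ∷ ys) = cong (y ∷_) (map-proj₂-zip xs ys)

  ∈-zip⊎drop : ∀ {x : A} (xs : List A) (ys : List B) → x ∈ xs →
               (∃ λ y → (x , y) ∈ zip xs ys) ⊎ x ∈ drop (length ys) xs
  ∈-zip⊎drop xs       []       x∈          = inj₂ x∈
  ∈-zip⊎drop (x ∷ xs) (y ∷ ys) (here refl) = inj₁ (y , here refl)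
  ∈-zip⊎drop (x ∷ xs) (y ∷ ys) (there x∈) with ∈-zip⊎drop xs ys x∈
  ... | inj₁ (y′ , xy∈) = inj₁ (y′ , there xy∈)
  ... | inj₂ x∈drop     = inj₂ x∈drop

  concatMap-cong-local : ∀ {f g : A → List B} {xs} → (∀ {x} → x ∈ xs → f x ≡ g x) → concatMap f xs ≡ concatMap g xs
  concatMap-cong-local f≡g = cong concat (map-cong-local (All.tabulate f≡g))

  concatMap-unique : ∀ (f : A → List B) → (∀ x → Unique (f x)) →
                     (∀ {x x′ y} → y ∈ f x → y ∈ f x′ → x ≡ x′) → ∀ {xs} → Unique xs → Unique (concatMap f xs)
  concatMap-unique f f-unique disjoint xs-unique = Unique.concat⁺
    (All.map⁺ (All.universal f-unique _))
    (AllPairs.map⁺ (AllPairs.map (λ x≢x′ {_} (y∈ , y∈′) → x≢x′ (disjoint y∈ y∈′)) xs-unique))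

  length-concatMap : ∀ (f : A → List B) xs → length (concatMap f xs) ≡ sum (map (length ∘ f) xs)
  length-concatMap f []       = refl
  length-concatMap f (x ∷ xs) = trans (length-++ (f x)) (cong (length (f x) +_) (length-concatMap f xs))

  length-cartesianProduct : ∀ (xs : List A) (ys : List B) → length (cartesianProduct xs ys) ≡ length xs * length ys
  length-cartesianProduct []       ys = refl
  length-cartesianProduct (x ∷ xs) ys = trans (length-++ (map (x ,_) ys))
    (cong₂ _+_ (length-map (x ,_) ys) (length-cartesianProduct xs ys))

  injection⇒length≤ : ∀ (R : A → B → Set) → (∀ {x x′ y} → R x y → R x′ y → x ≡ x′) →
    ∀ {xs ys} → Unique xs → (∀ {x} → x ∈ xs → ∃ λ y → y ∈ ys × R x y) → length xs ≤ length ys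
  injection⇒length≤ R injective []               image = z≤n
  injection⇒length≤ R injective (x∉ ∷ xs-unique) image with image (here refl)
  ... | y , y∈ys , Rxy with ls , rs , refl ← ∈-∃++ y∈ys =
    ≤-trans (s≤s (injection⇒length≤ R injective xs-unique image-rest)) (≤-reflexive (sym (↭-length (shift y ls rs))))
    where
    image-rest : ∀ {x′} → x′ ∈ _ → ∃ λ y′ → y′ ∈ ls ++ rs × R x′ y′
    image-rest x′∈ with image (there x′∈)
    ... | y′ , y′∈ , Rx′y′ with ∈-resp-↭ (shift y ls rs) y′∈
    ... | here refl = contradiction (injective Rxy Rx′y′) (All.lookup x∉ x′∈)
    ... | there y′∈rest = y′ , y′∈rest , Rx′y′

  length-filter-∷ : ∀ {P : A → Set} (P? : ∀ x → Dec (P x)) x xs →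
    length (filter P? (x ∷ xs)) ≡ indicator (P? x) + length (filter P? xs)
  length-filter-∷ P? x xs with P? x
  ... | yes _ = refl
  ... | no  _ = refl

  ∑-length-filter : ∀ {P : ℕ → A → Set} (P? : ∀ i x → Dec (P i x)) n k →
    (∀ x → ∑[ i < n ] indicator (P? i x) ≤ k) →
    ∀ xs → ∑[ i < n ] length (filter (P? i) xs) ≤ length xs * k
  ∑-length-filter P? n k le []       = ≤-reflexive (∑-zero n λ _ _ → refl)
  ∑-length-filter P? n k le (x ∷ xs) = begin
    ∑[ i < n ] length (filter (P? i) (x ∷ xs))                                ≡⟨ ∑-cong n (λ i _ → length-filter-∷ (P? i) x xs) ⟩
    ∑[ i < n ] (indicator (P? i x) + length (filter (P? i) xs))               ≡⟨ ∑-distrib-+ n _ _ ⟩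
    ∑[ i < n ] indicator (P? i x) + ∑[ i < n ] length (filter (P? i) xs)      ≤⟨ +-mono-≤ (le x) (∑-length-filter P? n k le xs) ⟩
    k + length xs * k                                                         ∎
    where open ≤-Reasoning

module EDF {Name : Set} where

  open ListProperties
  open Sequences
  open import Data.List using (List; []; _∷_; _++_; drop; filter; map; take; zip)
  open import Data.List.Membership.Propositional using (_∈_)
  open import Data.List.Membership.Propositional.Properties using (∈-++⁻; ∈-++⁺ˡ; ∈-++⁺ʳ; ∈-filter⁺; ∈-length)
  open import Data.List.Properties using (length-++; filter-++; filter-none; filter-accept)
  open import Data.List.Relation.Binary.Permutation.Propositional using (_↭_; ↭-sym)
  open import Data.List.Relation.Binary.Permutation.Propositional.Properties using (↭-length; filter-↭; ∈-resp-↭)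
  open import Data.List.Relation.Unary.All as All using (All; []; _∷_)
  import Data.List.Relation.Unary.All.Properties as All
  open import Data.List.Relation.Unary.AllPairs using (AllPairs; []; _∷_)
  open import Data.List.Relation.Unary.Linked.Properties using (Linked⇒AllPairs)
  import Data.List.Sort as Sort
  open import Data.Nat
  open import Data.Nat.Properties
  open import Data.Sum as Sum using (_⊎_; inj₁; inj₂; [_,_]′)
  open import Function using (id)
  import Relation.Binary.Construct.On as On
  open import Relation.Nullary using (Dec; yes; no)

  Task : Set
  Task = ℕ × Name

  dueAt : Task → ℕ
  dueAt = proj₁

  Arrivals : Set
  Arrivals = ℕ → List Task

  dueBy? : ∀ D j → Dec (dueAt j ≤ D)
  dueBy? D j = dueAt j ≤? D

  due : ℕ → List Task → ℕ
  due D ts = length (filter (dueBy? D) ts)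

  due-++ : ∀ D xs ys → due D (xs ++ ys) ≡ due D xs + due D ys
  due-++ D xs ys = trans (cong length (filter-++ (dueBy? D) xs ys)) (length-++ (filter (dueBy? D) xs))

  due-↭ : ∀ D {xs ys} → xs ↭ ys → due D xs ≡ due D ys
  due-↭ D xs↭ys = ↭-length (filter-↭ (dueBy? D) xs↭ys)

  ∈⇒due>0 : ∀ {D j xs} → j ∈ xs → dueAt j ≤ D → 0 < due D xs
  ∈⇒due>0 {D} j∈ d≤D = ∈-length (∈-filter⁺ (dueBy? D) j∈ d≤D)

  EarliestFirst : List Task → Set
  EarliestFirst = AllPairs (λ i j → dueAt i ≤ dueAt j)

  due-drop : ∀ D n {xs} → EarliestFirst xs → due D (drop n xs) ≡ due D xs ∸ n
  due-drop D zero    _  = refl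
  due-drop D (suc n) [] = refl
  due-drop D (suc n) {x ∷ xs} (x≤xs ∷ sorted) with dueBy? D x
  ... | yes x≤D = trans (due-drop D n sorted)
                        (cong (λ ys → length ys ∸ suc n) (sym (filter-accept (dueBy? D) x≤D)))
  ... | no  x≰D = trans (none-due (All.drop⁺ n x≤xs)) (cong (_∸ suc n) (sym (none-due (≤-refl ∷ x≤xs))))
    where
    none-due : ∀ {ys} → All (λ j → dueAt x ≤ dueAt j) ys → due D ys ≡ 0
    none-due x≤ys = cong length (filter-none (dueBy? D) (All.map (λ x≤j j≤D → x≰D (≤-trans x≤j j≤D)) x≤ys))

  released : Arrivals → (D s n : ℕ) → ℕ
  released a D s n = ∑[ i < n ] due D (a (s + i))

  open Sort (On.decTotalOrder ≤-decTotalOrder dueAt) using (sort; sort-↭; sort-↗)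

  module _ {Machine : Set} (machines : ℕ → List Machine) (arrivals : Arrivals) where

    opaque
      mutual
        backlog : ℕ → List Task
        backlog zero    = []
        backlog (suc t) = drop (length (machines t)) (queue t)

        queue : ℕ → List Task
        queue t = sort (backlog t ++ arrivals t)

      served : ℕ → List (Task × Machine)
      served t = zip (queue t) (machines t)

      ∈-queue⁻ : ∀ t {j} → j ∈ queue t → j ∈ backlog t ⊎ j ∈ arrivals t
      ∈-queue⁻ t j∈ = ∈-++⁻ (backlog t) (∈-resp-↭ (sort-↭ _) j∈)

      backlog⊆queue : ∀ t {j} → j ∈ backlog t → j ∈ queue t
      backlog⊆queue t j∈ = ∈-resp-↭ (↭-sym (sort-↭ _)) (∈-++⁺ˡ j∈)

      arrivals⊆queue : ∀ t {j} → j ∈ arrivals t → j ∈ queue t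
      arrivals⊆queue t j∈ = ∈-resp-↭ (↭-sym (sort-↭ _)) (∈-++⁺ʳ (backlog t) j∈)

      postponed : ∀ t {j} → j ∈ backlog (suc t) → j ∈ queue t
      postponed t = ∈-drop⁻ (length (machines t))

      served⊎backlog : ∀ t {j} → j ∈ queue t → (∃ λ c → (j , c) ∈ served t) ⊎ j ∈ backlog (suc t)
      served⊎backlog t = ∈-zip⊎drop (queue t) (machines t)

      ∈-served⁻ : ∀ t {j c} → (j , c) ∈ served t → j ∈ queue t × c ∈ machines t
      ∈-served⁻ t = ∈-zip⁻ (queue t) (machines t)

      map-proj₂-served : ∀ t → map proj₂ (served t) ≡ take (length (queue t)) (machines t)
      map-proj₂-served t = map-proj₂-zip (queue t) (machines t)

      backlog-zero : backlog 0 ≡ []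
      backlog-zero = refl

      due-backlog-suc : ∀ D t → due D (backlog (suc t)) ≡ due D (backlog t) + due D (arrivals t) ∸ length (machines t)
      due-backlog-suc D t = trans
        (due-drop D (length (machines t)) (Linked⇒AllPairs ≤-trans (sort-↗ (backlog t ++ arrivals t))))
        (cong (_∸ length (machines t))
          (trans (due-↭ D (sort-↭ (backlog t ++ arrivals t))) (due-++ D (backlog t) (arrivals t))))

    queue-origin : ∀ t {j} → j ∈ queue t → ∃ λ s → s ≤ t × j ∈ arrivals s
    queue-origin t j∈ with ∈-queue⁻ t j∈
    queue-origin t       j∈ | inj₂ j∈arrivals = t , ≤-refl , j∈arrivals
    queue-origin zero    j∈ | inj₁ j∈backlog with () ← subst (_ ∈_) backlog-zero j∈backlog
    queue-origin (suc t) j∈ | inj₁ j∈backlog  =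
      let s , s≤t , j∈arrivals = queue-origin t (postponed t j∈backlog) in s , m≤n⇒m≤1+n s≤t , j∈arrivals

    Served : Task → Set
    Served j = ∃ λ t → ∃ λ c → (j , c) ∈ served t

    served⊎waiting : ∀ s {j} → j ∈ arrivals s → ∀ n → Served j ⊎ j ∈ backlog (suc s + n)
    served⊎waiting s j∈ zero    rewrite +-identityʳ s = Sum.map₁ (s ,_) (served⊎backlog s (arrivals⊆queue s j∈))
    served⊎waiting s j∈ (suc n) rewrite +-suc s n =
      [ inj₁ , (λ waiting → Sum.map₁ (_ ,_) (served⊎backlog _ (backlog⊆queue _ waiting))) ]′ (served⊎waiting s j∈ n)

    capacity : (s n : ℕ) → ℕ
    capacity s n = ∑[ i < n ] length (machines (s + i))

    Sufficient : ℕ → Set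
    Sufficient D = ∀ s n → s + n ≡ D → released arrivals D s n ≤ capacity s n

    -- Lindley's recursion.
    backlog-bound : ∀ {D} → Sufficient D → ∀ t n → t + n ≡ D →
      due D (backlog t) + released arrivals D t n ≤ capacity t n
    backlog-bound {D} sufficient zero    n t+n≡D =
      ≤-trans (≤-reflexive (cong (λ ts → due D ts + released arrivals D 0 n) backlog-zero)) (sufficient 0 n t+n≡D)
    backlog-bound {D} sufficient (suc t) n t+n≡D with ≤-total (due D (backlog t) + due D (arrivals t)) (length (machines t))
    ... | inj₁ cleared = begin
      due D (backlog (suc t)) + released arrivals D (suc t) n   ≡⟨ cong (_+ released arrivals D (suc t) n) nothing-left ⟩
      released arrivals D (suc t) n                             ≤⟨ sufficient (suc t) n t+n≡D ⟩
      capacity (suc t) n                                        ∎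
      where
      open ≤-Reasoning
      nothing-left : due D (backlog (suc t)) ≡ 0
      nothing-left = trans (due-backlog-suc D t) (m≤n⇒m∸n≡0 cleared)
    ... | inj₂ saturated = +-cancelˡ-≤ (length (machines t)) _ _ (begin
      M + (due D (backlog (suc t)) + R)                         ≡⟨ +-assoc M _ R ⟨
      M + due D (backlog (suc t)) + R                           ≡⟨ cong (λ b → M + b + R) (due-backlog-suc D t) ⟩
      M + (due D (backlog t) + due D (arrivals t) ∸ M) + R      ≡⟨ cong (_+ R) (m+[n∸m]≡n saturated) ⟩
      due D (backlog t) + due D (arrivals t) + R                ≡⟨ +-assoc (due D (backlog t)) _ R ⟩
      due D (backlog t) + (due D (arrivals t) + R)              ≡⟨ cong (due D (backlog t) +_) (∑-head t n (λ u → due D (arrivals u))) ⟨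
      due D (backlog t) + released arrivals D t (suc n)         ≤⟨ backlog-bound sufficient t (suc n) (trans (+-suc t n) t+n≡D) ⟩
      capacity t (suc n)                                        ≡⟨ ∑-head t n (λ u → length (machines u)) ⟩
      M + capacity (suc t) n                                    ∎)
      where
      open ≤-Reasoning
      M R : ℕ
      M = length (machines t)
      R = released arrivals D (suc t) n

    nothing-late : ∀ {D} → Sufficient D → ∀ {j} → j ∈ backlog D → D < dueAt j
    nothing-late {D} sufficient j∈ = ≰⇒> λ d≤D → <⇒≱ (∈⇒due>0 j∈ d≤D) (begin
      due D (backlog D)                                 ≤⟨ m≤m+n _ _ ⟩
      due D (backlog D) + released arrivals D D 0       ≤⟨ backlog-bound sufficient D 0 (+-identityʳ D) ⟩
      capacity D 0                                      ≡⟨ ∑-zero 0 (λ _ ()) ⟩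
      0                                                 ∎)
      where open ≤-Reasoning

    module _ (timely : ∀ t {j} → j ∈ arrivals t → t < dueAt j)
             (sufficient : ∀ t {j} → j ∈ arrivals t → Sufficient (dueAt j)) where

      queue-timely : ∀ t {j} → j ∈ queue t → t < dueAt j
      queue-timely t j∈ with ∈-queue⁻ t j∈
      queue-timely t       j∈ | inj₂ j∈arrivals = timely t j∈arrivals
      queue-timely zero    j∈ | inj₁ j∈backlog with () ← subst (_ ∈_) backlog-zero j∈backlog
      queue-timely (suc t) j∈ | inj₁ j∈backlog
        with m≤n⇒m<n∨m≡n (queue-timely t (postponed t j∈backlog)) | queue-origin (suc t) j∈
      ... | inj₁ 1+t<d | _ = 1+t<d
      ... | inj₂ 1+t≡d | s , _ , j∈s = nothing-late (subst Sufficient (sym 1+t≡d) (sufficient s j∈s)) j∈backlog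

      all-served : ∀ s {j} → j ∈ arrivals s → Served j
      all-served s {j} j∈ = [ id , (λ waiting → contradiction (nothing-late (sufficient s j∈) waiting) (<-irrefl refl)) ]′
        (subst (λ t → Served j ⊎ j ∈ backlog t) (m+[n∸m]≡n (timely s j∈)) (served⊎waiting s j∈ (dueAt j ∸ suc s)))

  module _ {Machine : Set} {m m′ : ℕ → List Machine} {a a′ : Arrivals} where

    opaque
      unfolding queue

      queue-cong : ∀ t → AgreeUpTo t m m′ → AgreeUpTo t a a′ → queue m a t ≡ queue m′ a′ t
      queue-cong zero    m≡ a≡ = cong sort (a≡ 0 z≤n)
      queue-cong (suc t) m≡ a≡ = cong₂ (λ ls rs → sort (ls ++ rs))
        (cong₂ (λ c → drop (length c)) (m≡ t (n≤1+n t))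
          (queue-cong t (AgreeUpTo-≤ (n≤1+n t) m≡) (AgreeUpTo-≤ (n≤1+n t) a≡)))
        (a≡ (suc t) ≤-refl)

      served-cong : ∀ t → AgreeUpTo t m m′ → AgreeUpTo t a a′ → served m a t ≡ served m′ a′ t
      served-cong t m≡ a≡ = cong₂ zip (queue-cong t m≡ a≡) (m≡ t ≤-refl)

module Density {Name : Set} (T : ℕ) where

  open Division
  open EDF {Name}
  open HarmonicDensity using (total≤3∑density)
  open Sequences
  open import Data.List using (List; []; cartesianProduct; map; upTo)
  open import Data.List.Extrema.Nat using (max; xs≤max; max≤v⁺)
  open import Data.List.Membership.Propositional.Properties
    using (∈-map⁺; ∈-upTo⁺; ∈-upTo⁻; ∈-cartesianProduct⁺; ∈-cartesianProduct⁻)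
  open import Data.List.Properties using (map-cong-local)
  open import Data.List.Relation.Unary.All as All using (All)
  import Data.List.Relation.Unary.All.Properties as All
  open import Data.Nat
  open import Data.Nat.Properties
  open import Data.Sum using (_⊎_; inj₁; inj₂)

  -- The tasks released in [b , t] whose window lies within the l + 1 slots from b on.
  load : Arrivals → (t b l : ℕ) → ℕ
  load a t b l = released a (b + suc l) b (suc t ∸ b)

  windows : ℕ → List (ℕ × ℕ)
  windows t = cartesianProduct (upTo (suc t)) (upTo T)

  All-windows : ∀ {P : ℕ × ℕ → Set} t → (∀ b l → b ≤ t → l < T → P (b , l)) → All P (windows t)
  All-windows t f = All.tabulate λ {(b , l)} bl∈ →
    let b∈ , l∈ = ∈-cartesianProduct⁻ (upTo (suc t)) (upTo T) bl∈ in f b l (s≤s⁻¹ (∈-upTo⁻ b∈)) (∈-upTo⁻ l∈)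

  load-cong : ∀ {a a′ t} b l → AgreeUpTo t a a′ → b ≤ t → load a t b l ≡ load a′ t b l
  load-cong {t = t} b l a≡a′ b≤t = ∑-cong (suc t ∸ b) λ i i< → cong (due (b + suc l))
    (a≡a′ (b + i) (s≤s⁻¹ (≤-trans (+-monoʳ-< b i<) (≤-reflexive (m+[n∸m]≡n (m≤n⇒m≤1+n b≤t))))))

  opaque
    density : Arrivals → ℕ → ℕ
    density a t = max 0 (map (λ (b , l) → ⌈ load a t b l / suc l ⌉) (windows t))

    load≤density : ∀ a t b l → b ≤ t → l < T → load a t b l ≤ density a t * suc l
    load≤density a t b l b≤t l<T = ≤-trans (m≤⌈m/n⌉*n (load a t b l) (suc l)) (*-monoˡ-≤ (suc l)
      (All.lookup (xs≤max 0 _) (∈-map⁺ _ (∈-cartesianProduct⁺ (∈-upTo⁺ (s≤s b≤t)) (∈-upTo⁺ l<T)))))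

    density-least : ∀ a t {X} → (∀ b l → b ≤ t → l < T → load a t b l ≤ X * suc l) → density a t ≤ X
    density-least a t load≤ = max≤v⁺ z≤n (All.map⁺ (All-windows t λ b l b≤t l<T →
      m≤o*n⇒⌈m/n⌉≤o _ (suc l) _ (load≤ b l b≤t l<T)))

    density-cong : ∀ {a a′} t → AgreeUpTo t a a′ → density a t ≡ density a′ t
    density-cong t a≡a′ = cong (max 0) (map-cong-local (All-windows t λ b l b≤t _ →
      cong (λ m → ⌈ m / suc l ⌉) (load-cong b l a≡a′ b≤t)))

  load-suc : ∀ a t b l → b ≤ suc t → load a (suc t) b l ≡ load a t b l + due (b + suc l) (a (suc t))
  load-suc a t b l b≤1+t = begin
    ∑[ i < suc (suc t) ∸ b ] f (b + i)                  ≡⟨ cong (λ n → ∑[ i < n ] f (b + i)) (+-∸-assoc 1 b≤1+t) ⟩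
    ∑[ i < suc (suc t ∸ b) ] f (b + i)                  ≡⟨ ∑-last (suc t ∸ b) (λ i → f (b + i)) ⟩
    load a t b l + f (b + (suc t ∸ b))                  ≡⟨ cong (λ u → load a t b l + f u) (m+[n∸m]≡n b≤1+t) ⟩
    load a t b l + f (suc t)                            ∎
    where
    open ≡-Reasoning
    f : ℕ → ℕ
    f u = due (b + suc l) (a u)

  density-mono : ∀ a t → density a t ≤ density a (suc t)
  density-mono a t = density-least a t λ b l b≤t l<T → begin
    load a t b l                                        ≤⟨ m≤m+n _ _ ⟩
    load a t b l + due (b + suc l) (a (suc t))          ≡⟨ load-suc a t b l (m≤n⇒m≤1+n b≤t) ⟨
    load a (suc t) b l                                  ≤⟨ load≤density a (suc t) b l (m≤n⇒m≤1+n b≤t) l<T ⟩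
    density a (suc t) * suc l                           ∎
    where open ≤-Reasoning

  density-idle : ∀ a t → a (suc t) ≡ [] → density a (suc t) ≤ density a t
  density-idle a t idle = density-least a (suc t) λ b l b≤1+t l<T → begin
    load a (suc t) b l                                  ≡⟨ load-suc a t b l b≤1+t ⟩
    load a t b l + due (b + suc l) (a (suc t))          ≡⟨ cong (λ ts → load a t b l + due (b + suc l) ts) idle ⟩
    load a t b l + 0                                    ≡⟨ +-identityʳ _ ⟩
    load a t b l                                        ≤⟨ load≤ b l (m≤n⇒m<n∨m≡n b≤1+t) l<T ⟩
    density a t * suc l                                 ∎
    where
    open ≤-Reasoning
    load≤ : ∀ b l → b < suc t ⊎ b ≡ suc t → l < T → load a t b l ≤ density a t * suc l
    load≤ b l (inj₁ b≤t)  l<T = load≤density a t b l (s≤s⁻¹ b≤t) l<T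
    load≤ _ l (inj₂ refl) _   = ≤-trans (≤-reflexive empty) z≤n
      where
      empty : load a t (suc t) l ≡ 0
      empty = trans (cong (λ n → ∑[ i < n ] due (suc t + suc l) (a (suc t + i))) (n∸n≡0 t)) (∑-zero 0 λ _ ())

  released≤3∑density : ∀ a {D} s n → s + n ≡ D → D ≤ T → released a D s n ≤ 3 * ∑[ i < n ] density a (s + i)
  released≤3∑density a {D} s n refl D≤T = total≤3∑density n _ _ dense
    where
    open ≤-Reasoning
    dense : ∀ b j l → b + suc j + l ≡ n →
            ∑[ i < suc j ] due D (a (s + (b + i))) ≤ density a (s + (b + j)) * suc (j + l)
    dense b j l refl = begin
      ∑[ i < suc j ] due D (a (s + (b + i)))    ≡⟨ ∑-cong (suc j) (λ i _ → cong (λ u → due D (a u)) (+-assoc s b i)) ⟨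
      released a D (s + b) (suc j)              ≡⟨ cong₂ (λ D n → released a D (s + b) n) (deadline≡ s b j l) length≡ ⟩
      load a (s + (b + j)) (s + b) (j + l)      ≤⟨ load≤density a _ _ _ (+-monoʳ-≤ s (m≤m+n b j)) (≤-trans length≤D D≤T) ⟩
      density a (s + (b + j)) * suc (j + l)     ∎
      where
      deadline≡ : ∀ s b j l → s + (b + suc j + l) ≡ s + b + suc (j + l)
      deadline≡ = solve-∀
      end≡ : ∀ s b j → suc (s + (b + j)) ≡ s + b + suc j
      end≡ = solve-∀
      length≡ : suc j ≡ suc (s + (b + j)) ∸ (s + b)
      length≡ = sym (trans (cong (_∸ (s + b)) (end≡ s b j)) (m+n∸m≡n (s + b) (suc j)))
      length≤D : suc (j + l) ≤ D
      length≤D = ≤-trans (m≤n+m _ (s + b)) (≤-reflexive (sym (deadline≡ s b j l)))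

module Banks where

  open ListProperties
  open Sequences
  open import Data.List using (List; concatMap; map; upTo)
  open import Data.List.Membership.Propositional using (_∈_; find)
  open import Data.List.Membership.Propositional.Properties using (∈-map⁻; ∈-upTo⁻; ∈-concatMap⁻)
  open import Data.List.Properties using (length-map; length-upTo; map-cong)
  open import Data.List.Relation.Unary.Unique.Propositional using (Unique)
  import Data.List.Relation.Unary.Unique.Propositional.Properties as Unique
  open import Data.Nat
  open import Data.Nat.ListAction using (sum)
  open import Data.Nat.Properties
  open import Function using (_∘_)

  batch : ℕ → ℕ → List CalId
  batch u n = map (u ,_) (upTo n)

  ∈-batch⁻ : ∀ {u n c} → c ∈ batch u n → proj₁ c ≡ u × proj₂ c < n
  ∈-batch⁻ {u} c∈ with k , k∈ , refl ← ∈-map⁻ (u ,_) c∈ = refl , ∈-upTo⁻ k∈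

  length-batch : ∀ u n → length (batch u n) ≡ n
  length-batch u n = trans (length-map (u ,_) (upTo n)) (length-upTo n)

  -- By time s + y there are size y calibrations, as long as size is monotone.
  opaque
    bank : ℕ → (ℕ → ℕ) → ℕ → List CalId
    bank s size t = concatMap (λ y → batch (s + y) (increment size y)) (upTo (suc t))

    bank-cong : ∀ s {size size′} t → AgreeUpTo t size size′ → bank s size t ≡ bank s size′ t
    bank-cong s t size≡size′ = concatMap-cong-local λ {y} y∈ →
      cong (batch (s + y)) (increment-cong (AgreeUpTo-≤ (s≤s⁻¹ (∈-upTo⁻ y∈)) size≡size′))

    length-bank : ∀ s {size} → (∀ t → size t ≤ size (suc t)) → ∀ t → length (bank s size t) ≡ size t
    length-bank s {size} size-mono t = begin
      length (bank s size t)                        ≡⟨ length-concatMap batches (upTo (suc t)) ⟩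
      sum (map (length ∘ batches) (upTo (suc t)))   ≡⟨ cong sum (map-cong length-batches (upTo (suc t))) ⟩
      sum (map (increment size) (upTo (suc t)))     ≡⟨ sum-map-upTo (increment size) (suc t) ⟩
      ∑ (suc t) (increment size)                    ≡⟨ ∑-increment size-mono t ⟩
      size t                                        ∎
      where
      open ≡-Reasoning
      batches : ℕ → List CalId
      batches y = batch (s + y) (increment size y)
      length-batches : ∀ y → length (batches y) ≡ increment size y
      length-batches y = length-batch (s + y) (increment size y)

    ∈-bank⁻ : ∀ s size t {u k} → (u , k) ∈ bank s size t → ∃ λ y → y ≤ t × u ≡ s + y × k < increment size y
    ∈-bank⁻ s size t uk∈ =
      let y , y∈ , uk∈batch = find (∈-concatMap⁻ (λ y → batch (s + y) (increment size y)) {upTo (suc t)} uk∈)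
      in y , s≤s⁻¹ (∈-upTo⁻ y∈) , ∈-batch⁻ uk∈batch

    bank-unique : ∀ s size t → Unique (bank s size t)
    bank-unique s size t = concatMap-unique (λ y → batch (s + y) (increment size y))
      (λ y → Unique.map⁺ (cong proj₂) (Unique.upTo⁺ (increment size y)))
      (λ {y} {y′} uk∈ uk∈′ → +-cancelˡ-≡ s y y′ (trans (sym (proj₁ (∈-batch⁻ uk∈))) (proj₁ (∈-batch⁻ uk∈′))))
      (Unique.upTo⁺ (suc t))

module BlockAlgorithm (T lam L : ℕ) {{L≢0 : NonZero L}} where

  open Banks
  open Density {JobId} T
  open Division
  open EDF {JobId}
  open ListProperties
  open Sequences
  open import Data.Fin using (Fin; toℕ; fromℕ<)
  open import Data.Fin.Properties using (toℕ<n; toℕ-injective; toℕ-fromℕ<)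
  open import Data.List using (List; []; allFin; concatMap; filter; lookup; map; take; upTo)
  open import Data.List.Membership.Propositional using (_∈_; find; lose)
  open import Data.List.Membership.Propositional.Properties
    using (∈-allFin; ∈-concatMap⁺; ∈-concatMap⁻; ∈-filter⁺; ∈-filter⁻; ∈-map⁺; ∈-map⁻; ∈-upTo⁺)
  open import Data.List.Properties using (concatMap-cong; filter-none; map-concatMap; map-∘)
  open import Data.List.Relation.Unary.All as All using ()
  open import Data.List.Relation.Unary.Unique.Propositional using (Unique)
  import Data.List.Relation.Unary.Unique.Propositional.Properties as Unique
  open import Data.Nat
  open import Data.Nat.DivMod using (_/_; _%_; m%n<n)
  open import Data.Nat.Properties
  open import Data.Product using (map₁)
  open import Data.Vec as Vec using (Vec)
  open import Data.Vec.Properties using (lookup∘tabulate)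
  open import Function using (_∘_)
  open import Relation.Nullary using (yes; no)
  open import Relation.Nullary.Decidable using (decidable-stable)
  open import Algebra.Properties.CommutativeSemigroup +-commutativeSemigroup using (xy∙z≈xz∙y)

  padded : ∀ {n} → Vec (List ℕ) n → ℕ → List ℕ
  padded {n} v t with t <? n
  ... | yes t<n = Vec.lookup v (fromℕ< t<n)
  ... | no  _   = []

  padded-history : ∀ I t → AgreeUpTo t (padded (history I t)) (arr I)
  padded-history I t u u≤t with u <? suc t
  ... | yes u<1+t = trans (lookup∘tabulate (λ i → arr I (toℕ i)) (fromℕ< u<1+t)) (cong (arr I) (toℕ-fromℕ< u<1+t))
  ... | no  u≮1+t = contradiction (s≤s u≤t) u≮1+t

  -- Block i consists of the jobs released in [iL , iL + L).  Its local time x is the slot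
  -- firstSlot i + x, where the calibrations started at time iL + x become usable.
  firstSlot : ℕ → ℕ
  firstSlot i = i * L + lam

  localTask : ∀ i s (ds : List ℕ) → Fin (length ds) → Task
  localTask i s ds f = lookup ds f ∸ firstSlot i , (s , toℕ f)

  blockArrivals : (ℕ → List ℕ) → ℕ → Arrivals
  blockArrivals h i x =
    filter (λ _ → x <? L) (map (localTask i (i * L + x) (h (i * L + x))) (allFin (length (h (i * L + x)))))

  machineCount : Arrivals → ℕ → ℕ
  machineCount a x = 3 * density a x

  machineCount-mono : ∀ a x → machineCount a x ≤ machineCount a (suc x)
  machineCount-mono a x = *-monoʳ-≤ 3 (density-mono a x)

  blockMachines : (ℕ → List ℕ) → ℕ → ℕ → List CalId
  blockMachines h i = bank (i * L) (machineCount (blockArrivals h i))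

  blockServed : (ℕ → List ℕ) → ℕ → ℕ → List (Task × CalId)
  blockServed h i = served (blockMachines h i) (blockArrivals h i)

  blockRuns : (ℕ → List ℕ) → ℕ → ℕ → List (JobId × CalId)
  blockRuns h t i = map (map₁ proj₂) (blockServed h i (t ∸ firstSlot i))

  startedBlocks : ℕ → List ℕ
  startedBlocks t = filter (λ i → firstSlot i ≤? t) (upTo (suc t))

  algorithm : OnlineAlg
  algorithm t v = record
    { calibs = increment (machineCount (blockArrivals (padded v) (t / L))) (t % L)
    ; runs   = concatMap (blockRuns (padded v) t) (startedBlocks t)
    }

  -- Then all jobs of a block are due before the calibrations opened for it end.
  ShortWindows : Instance → Set
  ShortWindows I = ∀ j → deadline I j + L ≤ release I j + lam + T

  module _ {h h′ : ℕ → List ℕ} (i x : ℕ) (h≡h′ : AgreeUpTo (i * L + x) h h′) where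

    blockArrivals-cong : AgreeUpTo x (blockArrivals h i) (blockArrivals h′ i)
    blockArrivals-cong y y≤x = cong
      (λ ds → filter (λ _ → y <? L) (map (localTask i (i * L + y) ds) (allFin (length ds))))
      (h≡h′ (i * L + y) (+-monoʳ-≤ (i * L) y≤x))

    machineCount-cong : AgreeUpTo x (machineCount (blockArrivals h i)) (machineCount (blockArrivals h′ i))
    machineCount-cong y y≤x = cong (3 *_) (density-cong y (AgreeUpTo-≤ y≤x blockArrivals-cong))

    blockServed-cong : blockServed h i x ≡ blockServed h′ i x
    blockServed-cong = served-cong x
      (λ y y≤x → bank-cong (i * L) y (AgreeUpTo-≤ y≤x machineCount-cong)) blockArrivals-cong

  module _ (I : Instance) where

    block : ℕ → Arrivals
    block = blockArrivals (arr I)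

    machines : ℕ → ℕ → List CalId
    machines = blockMachines (arr I)

    task : ℕ → Job I → Task
    task i (s , f) = localTask i s (arr I s) f

    jobId : Job I → JobId
    jobId (s , f) = s , toℕ f

    blockQueue : ℕ → ℕ → List Task
    blockQueue i = queue (machines i) (block i)

    ∈-block⁻ : ∀ i x {j} → j ∈ block i x → x < L × ∃ λ f → j ≡ task i (i * L + x , f)
    ∈-block⁻ i x j∈ =
      let j∈map , x<L = ∈-filter⁻ (λ _ → x <? L) {xs = map (λ f → task i (i * L + x , f)) (allFin _)} j∈
          f , _ , j≡ = ∈-map⁻ (λ f → task i (i * L + x , f)) j∈map
      in x<L , f , j≡

    ∈-block⁺ : ∀ i x → x < L → ∀ f → task i (i * L + x , f) ∈ block i x
    ∈-block⁺ i x x<L f = ∈-filter⁺ (λ _ → x <? L) (∈-map⁺ (λ f → task i (i * L + x , f)) (∈-allFin f)) x<L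

    block-unique : ∀ i x → Unique (block i x)
    block-unique i x = Unique.filter⁺ (λ _ → x <? L)
      (Unique.map⁺ (λ eq → toℕ-injective (cong (proj₂ ∘ proj₂) eq)) (Unique.allFin⁺ (length (arr I (i * L + x)))))

    length-machines : ∀ i x → length (machines i x) ≡ machineCount (block i) x
    length-machines i = length-bank (i * L) (machineCount-mono (block i))

    calibs-algorithm : ∀ t → calibs (dec algorithm I t) ≡ increment (machineCount (block (t / L))) (t % L)
    calibs-algorithm t = increment-cong (machineCount-cong (t / L) (t % L)
      (AgreeUpTo-≤ (≤-reflexive ([m/n]*n+m%n≡m t L)) (padded-history I t)))

    calibs-block : ∀ i {x} → x < L → calibs (dec algorithm I (i * L + x)) ≡ increment (machineCount (block i)) x
    calibs-block i x<L = trans (calibs-algorithm _)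
      (cong₂ (λ i → increment (machineCount (block i))) ([m*n+o]/n≡m i x<L) ([m*n+o]%n≡o i x<L))

    increment>0⇒<L : ∀ i x {k} → k < increment (machineCount (block i)) x → x < L
    increment>0⇒<L i zero    _  = >-nonZero⁻¹ L
    increment>0⇒<L i (suc x) k< = decidable-stable (suc x <? L) λ x≮L →
      >⇒≢ (≤-<-trans z≤n k<) (m≤n⇒m∸n≡0 (*-monoʳ-≤ 3 (density-idle (block i) x
        (filter-none (λ _ → suc x <? L) {map (λ f → task i (i * L + suc x , f)) (allFin _)}
          (All.universal (λ _ → x≮L) _)))))

    runs-algorithm : ∀ t → runs (dec algorithm I t) ≡ concatMap (blockRuns (arr I) t) (startedBlocks t)
    runs-algorithm t = concatMap-cong-local λ {i} i∈ →
      let _ , started = ∈-filter⁻ (λ i → firstSlot i ≤? t) {xs = upTo (suc t)} i∈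
      in cong (map (map₁ proj₂)) (blockServed-cong i (t ∸ firstSlot i) (AgreeUpTo-≤ (begin
        i * L + (t ∸ firstSlot i)        ≤⟨ +-monoˡ-≤ _ (m≤m+n (i * L) lam) ⟩
        firstSlot i + (t ∸ firstSlot i)  ≡⟨ m+[n∸m]≡n started ⟩
        t                                ∎) (padded-history I t)))
      where open ≤-Reasoning

    ∈-runs⁻ : ∀ t {p} → p ∈ runs (dec algorithm I t) →
      ∃ λ i → ∃ λ x → t ≡ firstSlot i + x ×
      ∃ λ j → ∃ λ c → (j , c) ∈ blockServed (arr I) i x × p ≡ (proj₂ j , c)
    ∈-runs⁻ t p∈ =
      let i , i∈ , p∈i = find (∈-concatMap⁻ (blockRuns (arr I) t) {startedBlocks t}
            (subst (_ ∈_) (runs-algorithm t) p∈))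
          _ , started = ∈-filter⁻ (λ i → firstSlot i ≤? t) {xs = upTo (suc t)} i∈
          (j , c) , jc∈ , p≡ = ∈-map⁻ (map₁ proj₂) p∈i
      in i , t ∸ firstSlot i , sym (m+[n∸m]≡n started) , j , c , jc∈ , p≡

    ∈-runs⁺ : ∀ i x {j c} → (j , c) ∈ blockServed (arr I) i x →
              (proj₂ j , c) ∈ runs (dec algorithm I (firstSlot i + x))
    ∈-runs⁺ i x {j} {c} jc∈ = subst (_ ∈_) (sym (runs-algorithm t))
      (∈-concatMap⁺ (blockRuns (arr I) t) (lose started run))
      where
      t : ℕ
      t = firstSlot i + x
      started : i ∈ startedBlocks t
      started = ∈-filter⁺ (λ i → firstSlot i ≤? t)
        (∈-upTo⁺ (s≤s (≤-trans (m≤m*n i L) (≤-trans (m≤m+n (i * L) lam) (m≤m+n (firstSlot i) x)))))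
        (m≤m+n (firstSlot i) x)
      run : (proj₂ j , c) ∈ blockRuns (arr I) t i
      run = ∈-map⁺ (map₁ proj₂) (subst (λ x → (j , c) ∈ blockServed (arr I) i x) (sym (m+n∸m≡n (firstSlot i) x)) jc∈)

    machines-block : ∀ i x {u k} → (u , k) ∈ machines i x → u / L ≡ i
    machines-block i x uk∈ with y , _ , refl , k< ← ∈-bank⁻ (i * L) (machineCount (block i)) x uk∈ =
      [m*n+o]/n≡m i (increment>0⇒<L i y k<)

    runs-unique : ∀ t → Unique (map proj₂ (runs (dec algorithm I t)))
    runs-unique t = subst Unique (sym machines≡)
      (concatMap-unique used (λ i → Unique.take⁺ _ (bank-unique (i * L) _ _)) disjoint
        (Unique.filter⁺ (λ i → firstSlot i ≤? t) (Unique.upTo⁺ (suc t))))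
      where
      open ≡-Reasoning
      used : ℕ → List CalId
      used i = take (length (blockQueue i (t ∸ firstSlot i))) (machines i (t ∸ firstSlot i))
      used≡ : ∀ i → map proj₂ (blockRuns (arr I) t i) ≡ used i
      used≡ i = trans (sym (map-∘ (blockServed (arr I) i (t ∸ firstSlot i))))
                      (map-proj₂-served (machines i) (block i) (t ∸ firstSlot i))
      machines≡ : map proj₂ (runs (dec algorithm I t)) ≡ concatMap used (startedBlocks t)
      machines≡ = begin
        map proj₂ (runs (dec algorithm I t))                            ≡⟨ cong (map proj₂) (runs-algorithm t) ⟩
        map proj₂ (concatMap (blockRuns (arr I) t) (startedBlocks t))   ≡⟨ map-concatMap proj₂ (blockRuns (arr I) t) (startedBlocks t) ⟩
        concatMap (map proj₂ ∘ blockRuns (arr I) t) (startedBlocks t)   ≡⟨ concatMap-cong used≡ (startedBlocks t) ⟩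
        concatMap used (startedBlocks t)                                ∎
      block-of : ∀ {i c} → c ∈ used i → proj₁ c / L ≡ i
      block-of {i} c∈ = machines-block i (t ∸ firstSlot i) (∈-take⁻ (length (blockQueue i (t ∸ firstSlot i))) c∈)
      disjoint : ∀ {i i′ c} → c ∈ used i → c ∈ used i′ → i ≡ i′
      disjoint c∈ c∈′ = trans (sym (block-of c∈)) (block-of c∈′)

    calibrated : ∀ i x {c} → c ∈ machines i x → x < T → CalibratedAt T lam algorithm I c (firstSlot i + x)
    calibrated i x {u , k} c∈ x<T with y , y≤x , refl , k< ← ∈-bank⁻ (i * L) (machineCount (block i)) x c∈ =
      subst (k <_) (sym (calibs-block i (increment>0⇒<L i y k<))) k< , activated , running
      where
      open ≤-Reasoning
      activated : i * L + y + lam ≤ firstSlot i + x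
      activated = begin
        i * L + y + lam     ≡⟨ xy∙z≈xz∙y (i * L) y lam ⟩
        firstSlot i + y     ≤⟨ +-monoʳ-≤ (firstSlot i) y≤x ⟩
        firstSlot i + x     ∎
      running : firstSlot i + x < i * L + y + lam + T
      running = begin-strict
        firstSlot i + x         <⟨ +-monoʳ-< (firstSlot i) x<T ⟩
        firstSlot i + T         ≤⟨ +-monoˡ-≤ T (+-monoˡ-≤ lam (m≤m+n (i * L) y)) ⟩
        i * L + y + lam + T     ∎

    module _ (wf : WellFormed lam I) (short : ShortWindows I) where

      firstSlot+x<deadline : ∀ i x f → firstSlot i + x < deadline I (i * L + x , f)
      firstSlot+x<deadline i x f = begin-strict
        firstSlot i + x            ≡⟨ xy∙z≈xz∙y (i * L) lam x ⟩
        i * L + x + lam            <⟨ +-monoʳ-< (i * L + x) (n<1+n lam) ⟩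
        i * L + x + suc lam        ≤⟨ wf (i * L + x , f) ⟩
        deadline I (i * L + x , f) ∎
        where open ≤-Reasoning

      deadline≤firstSlot+T : ∀ i {x} → x < L → ∀ f → deadline I (i * L + x , f) ≤ firstSlot i + T
      deadline≤firstSlot+T i {x} x<L f = +-cancelʳ-≤ L _ _ (begin
        deadline I (i * L + x , f) + L     ≤⟨ short (i * L + x , f) ⟩
        i * L + x + lam + T                ≡⟨ regroup (i * L) x lam T ⟩
        firstSlot i + T + x                ≤⟨ +-monoʳ-≤ (firstSlot i + T) (<⇒≤ x<L) ⟩
        firstSlot i + T + L                ∎)
        where
        open ≤-Reasoning
        regroup : ∀ a x l T → a + x + l + T ≡ a + l + T + x
        regroup = solve-∀

      block-timely : ∀ i x {j} → j ∈ block i x → x < dueAt j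
      block-timely i x j∈ with _ , f , refl ← ∈-block⁻ i x j∈ =
        m+n≤o⇒m≤o∸n (suc x) (≤-trans (≤-reflexive (cong suc (+-comm x (firstSlot i)))) (firstSlot+x<deadline i x f))

      block-due≤T : ∀ i x {j} → j ∈ block i x → dueAt j ≤ T
      block-due≤T i x j∈ with x<L , f , refl ← ∈-block⁻ i x j∈ =
        m≤n+o⇒m∸n≤o _ (firstSlot i) (deadline≤firstSlot+T i x<L f)

      block-sufficient : ∀ i x {j} → j ∈ block i x → Sufficient (machines i) (block i) (dueAt j)
      block-sufficient i x {j} j∈ s n s+n≡d = begin
        released (block i) (dueAt j) s n                   ≤⟨ released≤3∑density (block i) s n s+n≡d (block-due≤T i x j∈) ⟩
        3 * ∑[ y < n ] density (block i) (s + y)           ≡⟨ *-distribˡ-∑ 3 n _ ⟩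
        ∑[ y < n ] machineCount (block i) (s + y)          ≡⟨ ∑-cong n (λ y _ → length-machines i (s + y)) ⟨
        ∑[ y < n ] length (machines i (s + y))             ∎
        where open ≤-Reasoning

      queued-job : ∀ i x {j} → j ∈ blockQueue i x →
        x < T × ∃ λ J → proj₂ j ≡ jobId J × release I J ≤ firstSlot i + x × firstSlot i + x < deadline I J
      queued-job i x {j} j∈ with queue-origin (machines i) (block i) x j∈
      ... | y , y≤x , j∈y with y<L , f , refl ← ∈-block⁻ i y j∈y =
        <-≤-trans x<due (block-due≤T i y j∈y) , (i * L + y , f) , refl ,
        +-mono-≤ (m≤m+n (i * L) lam) y≤x ,
        <-≤-trans (+-monoʳ-< (firstSlot i) x<due) (≤-reflexive (m+[n∸m]≡n firstSlot≤d))
        where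
        firstSlot≤d : firstSlot i ≤ deadline I (i * L + y , f)
        firstSlot≤d = ≤-trans (m≤m+n (firstSlot i) y) (<⇒≤ (firstSlot+x<deadline i y f))
        x<due : x < dueAt j
        x<due = queue-timely (machines i) (block i) (block-timely i) (block-sufficient i) x j∈

      run-legal : ∀ i x {j c} → (j , c) ∈ blockServed (arr I) i x →
                  LegalRun T lam algorithm I (firstSlot i + x) (proj₂ j , c)
      run-legal i x {c = c} jc∈ =
        let j∈ , c∈ = ∈-served⁻ (machines i) (block i) x jc∈
            x<T , J , j≡ , r≤t , t<d = queued-job i x j∈
        in subst (λ id → LegalRun T lam algorithm I (firstSlot i + x) (id , c)) (sym j≡)
             (toℕ<n (proj₂ J) , r≤t , in-time J t<d , calibrated i x c∈ x<T)
        where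
        in-time : ∀ J → firstSlot i + x < deadline I J →
                  ∀ f → toℕ f ≡ toℕ (proj₂ J) → firstSlot i + x < lookup (arr I (proj₁ J)) f
        in-time J t<d f f≡ = subst (λ f → _ < lookup (arr I (proj₁ J)) f) (sym (toℕ-injective f≡)) t<d

      legal : ∀ t {p} → p ∈ runs (dec algorithm I t) → LegalRun T lam algorithm I t p
      legal t p∈ = let i , x , t≡ , j , c , jc∈ , p≡ = ∈-runs⁻ t p∈ in
        subst₂ (LegalRun T lam algorithm I) (sym t≡) (sym p≡) (run-legal i x jc∈)

      Processed : Job I → Set
      Processed J = ∃ λ t → ∃ λ c → (jobId J , c) ∈ runs (dec algorithm I t)

      block-processed : ∀ i x → x < L → ∀ f → Processed (i * L + x , f)
      block-processed i x x<L f =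
        let y , c , served∈ = all-served (machines i) (block i) (block-timely i) (block-sufficient i) x (∈-block⁺ i x x<L f)
        in firstSlot i + y , c , ∈-runs⁺ i y served∈

      processed : ∀ J → Processed J
      processed (s , f) = subst (λ s → ∀ f → Processed (s , f)) ([m/n]*n+m%n≡m s L)
        (block-processed (s / L) (s % L) (m%n<n s L)) f

      feasible : Feasible T lam algorithm I
      feasible = (λ t → All.tabulate (legal t)) , runs-unique , processed

module DelayedSchedule {T lam : ℕ} {I : Instance} (wf : WellFormed lam I) (S : Schedule T lam I) where

  open import Data.Fin using (Fin; cast; combine; fromℕ<; quotient; remainder; toℕ)
  open import Data.Fin.Properties using (combine-injective; remQuot-combine; toℕ-cast; toℕ-fromℕ<; toℕ-injective)
  open import Data.List using (List; lookup; tabulate)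
  open import Data.List.Properties using (length-tabulate; lookup-tabulate)
  open import Data.Nat
  open import Data.Nat.Properties
  open import Data.Sum using (inj₁; inj₂)
  open import Algebra.Properties.CommutativeSemigroup +-commutativeSemigroup using (xy∙z≈xz∙y)

  slot : Job I → ℕ
  slot J = proj₂ (place S J)

  calStart : Job I → ℕ
  calStart J = lookup (cals S) (proj₁ (place S J))

  -- Copy d of a calibration is delayed by d ≤ lam: a job that S runs at τ < r + lam moves to
  -- slot r + lam of the copy delayed by r + lam - τ.
  delay : Job I → ℕ
  delay J = release I J + lam ∸ slot J

  delay≤lam : ∀ J → delay J ≤ lam
  delay≤lam J = m≤n+o⇒m∸n≤o _ (slot J) (+-monoˡ-≤ lam (rel S J))

  copyStart : Fin (length (cals S) * suc lam) → ℕ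
  copyStart v = lookup (cals S) (quotient (suc lam) v) + toℕ (remainder {length (cals S)} (suc lam) v)

  copy : Job I → Fin (length (cals S) * suc lam)
  copy J = combine (proj₁ (place S J)) (fromℕ< (s≤s (delay≤lam J)))

  copyStart-copy : ∀ J → copyStart (copy J) ≡ calStart J + delay J
  copyStart-copy J = trans
    (cong (λ (c , d) → lookup (cals S) c + toℕ d) (remQuot-combine (proj₁ (place S J)) (fromℕ< (s≤s (delay≤lam J)))))
    (cong (calStart J +_) (toℕ-fromℕ< (s≤s (delay≤lam J))))

  copy-slot-injective : ∀ {J J′} → copy J ≡ copy J′ → slot J + delay J ≡ slot J′ + delay J′ → J ≡ J′
  copy-slot-injective {J} {J′} copy≡ slot+delay≡ =
    let cal≡ , fromℕ<≡ = combine-injective (proj₁ (place S J)) _ (proj₁ (place S J′)) _ copy≡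
        delay≡ = trans (sym (toℕ-fromℕ< _)) (trans (cong toℕ fromℕ<≡) (toℕ-fromℕ< _))
    in inj S (cong₂ _,_ cal≡ (+-cancelʳ-≡ (delay J) _ _ (trans slot+delay≡ (cong (slot J′ +_) (sym delay≡)))))

  release+lam≤slot+delay : ∀ J → release I J + lam ≤ slot J + delay J
  release+lam≤slot+delay J = m≤n+m∸n _ (slot J)

  slot+delay<deadline : ∀ J → slot J + delay J < deadline I J
  slot+delay<deadline J with ≤-total (release I J + lam) (slot J)
  ... | inj₁ late  rewrite m≤n⇒m∸n≡0 late | +-identityʳ (slot J) = dl S J
  ... | inj₂ early rewrite m+[n∸m]≡n early = ≤-trans (≤-reflexive (sym (+-suc _ lam))) (wf J)

  delayedCals : List ℕ
  delayedCals = tabulate copyStart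

  delayedPlace : Job I → Fin (length delayedCals) × ℕ
  delayedPlace J = cast (sym (length-tabulate copyStart)) (copy J) , slot J + delay J

  delayedStart : ∀ J → lookup delayedCals (proj₁ (delayedPlace J)) ≡ calStart J + delay J
  delayedStart J = trans (lookup-tabulate copyStart (copy J)) (copyStart-copy J)

  delayedPlace-injective : ∀ {J J′} → delayedPlace J ≡ delayedPlace J′ → J ≡ J′
  delayedPlace-injective {J} {J′} place≡ = copy-slot-injective (toℕ-injective (begin
    toℕ (copy J)                       ≡⟨ toℕ-cast _ (copy J) ⟨
    toℕ (proj₁ (delayedPlace J))       ≡⟨ cong (λ p → toℕ (proj₁ p)) place≡ ⟩
    toℕ (proj₁ (delayedPlace J′))      ≡⟨ toℕ-cast _ (copy J′) ⟩
    toℕ (copy J′)                      ∎)) (cong proj₂ place≡)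
    where open ≡-Reasoning

  delayed : Schedule T lam I
  delayed = record
    { cals  = delayedCals
    ; place = delayedPlace
    ; inj   = delayedPlace-injective
    ; rel   = λ J → ≤-trans (rel S J) (m≤m+n (slot J) (delay J))
    ; dl    = slot+delay<deadline
    ; calLo = λ J → begin
        lookup delayedCals _ + lam     ≡⟨ cong (_+ lam) (delayedStart J) ⟩
        calStart J + delay J + lam        ≡⟨ xy∙z≈xz∙y (calStart J) (delay J) lam ⟩
        calStart J + lam + delay J        ≤⟨ +-monoˡ-≤ (delay J) (calLo S J) ⟩
        slot J + delay J               ∎
    ; calHi = λ J → begin-strict
        slot J + delay J                   <⟨ +-monoˡ-< (delay J) (calHi S J) ⟩
        calStart J + lam + T + delay J        ≡⟨ regroup (calStart J) lam T (delay J) ⟩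
        calStart J + delay J + lam + T        ≡⟨ cong (λ u → u + lam + T) (delayedStart J) ⟨
        lookup delayedCals _ + lam + T     ∎
    }
    where
    open ≤-Reasoning
    regroup : ∀ s l T d → s + l + T + d ≡ s + d + l + T
    regroup = solve-∀

  length-delayed : length (cals delayed) ≡ length (cals S) * suc lam
  length-delayed = length-tabulate copyStart

module OfflineBound (T lam L : ℕ) {{L≢0 : NonZero L}} where

  open BlockAlgorithm T lam L
  open Density {JobId} T
  open EDF {JobId}
  open ListProperties
  open Sequences
  open import Data.Fin using (Fin)
  open import Data.List using (List; allFin; applyUpTo; cartesianProduct; concatMap; filter; lookup; upTo)
  open import Data.List.Membership.Propositional using (_∈_; find)
  open import Data.List.Membership.Propositional.Properties
    using (∈-allFin; ∈-applyUpTo⁺; ∈-cartesianProduct⁺; ∈-concatMap⁻; ∈-filter⁺; ∈-filter⁻)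
  open import Data.List.Properties using (length-applyUpTo; length-tabulate)
  open import Data.List.Relation.Unary.Unique.Propositional using (Unique)
  import Data.List.Relation.Unary.Unique.Propositional.Properties as Unique
  open import Data.Nat
  open import Data.Nat.DivMod using (_/_; m*n/n≡m; /-monoˡ-≤; m<n*o⇒m/o<n)
  open import Data.Nat.Properties
  open import Function using (id)
  open import Relation.Nullary using (Dec)
  open import Relation.Nullary.Decidable using (_×-dec_)
  open import Algebra.Properties.CommutativeSemigroup +-commutativeSemigroup using (xy∙z≈xz∙y)

  -- A calibration started at u and the window of block i, both of length T, intersect.
  Meets : ℕ → ℕ → Set
  Meets i u = i * L < u + T × u < i * L + T

  meets? : ∀ i u → Dec (Meets i u)
  meets? i u = (i * L <? u + T) ×-dec (u <? i * L + T)

  common-slot⇒Meets : ∀ {i u τ} → firstSlot i ≤ τ → τ < firstSlot i + T → u + lam ≤ τ → τ < u + lam + T → Meets i u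
  common-slot⇒Meets {i} {u} first≤τ τ<end u+lam≤τ τ<u+lam+T =
    +-cancelʳ-< lam _ _ (<-≤-trans (≤-<-trans first≤τ τ<u+lam+T) (≤-reflexive (xy∙z≈xz∙y u lam T))) ,
    +-cancelʳ-< lam _ _ (<-≤-trans (≤-<-trans u+lam≤τ τ<end) (≤-reflexive (xy∙z≈xz∙y (i * L) lam T)))

  meets-count : ∀ k → 2 * T ≤ k * L → ∀ n u → ∑[ i < n ] indicator (meets? i u) ≤ k
  meets-count k 2T≤kL n u = begin
    ∑ n f                          ≤⟨ ∑-monoˡ-≤ f (m≤n+m n first) ⟩
    ∑ (first + n) f                ≡⟨ ∑-support first n k f below above ⟩
    ∑[ i < n ⊓ k ] f (first + i)   ≤⟨ ∑-mono-≤ (n ⊓ k) (λ i _ → indicator-≤1 (meets? (first + i) u)) ⟩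
    ∑[ _ < n ⊓ k ] 1               ≡⟨ trans (∑-const (n ⊓ k) 1) (*-identityʳ _) ⟩
    n ⊓ k                          ≤⟨ m⊓n≤n n k ⟩
    k                              ∎
    where
    open ≤-Reasoning
    f : ℕ → ℕ
    f i = indicator (meets? i u)
    last first : ℕ
    last = pred (u + T) / L
    first = suc last ∸ k
    meets⇒≤last : ∀ i → Meets i u → i ≤ last
    meets⇒≤last i (iL<u+T , _) = ≤-trans (≤-reflexive (sym (m*n/n≡m i L))) (/-monoˡ-≤ L (<⇒≤pred iL<u+T))
    meets⇒last<i+k : ∀ i → Meets i u → last < i + k
    meets⇒last<i+k i (_ , u<iL+T) = m<n*o⇒m/o<n (begin-strict
      pred (u + T)     ≤⟨ pred[n]≤n ⟩
      u + T            <⟨ +-monoˡ-< T u<iL+T ⟩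
      i * L + T + T    ≡⟨ double (i * L) T ⟩
      i * L + 2 * T    ≤⟨ +-monoʳ-≤ (i * L) 2T≤kL ⟩
      i * L + k * L    ≡⟨ *-distribʳ-+ L i k ⟨
      (i + k) * L      ∎)
      where
      double : ∀ a T → a + T + T ≡ a + 2 * T
      double = solve-∀
    below : ∀ i → i < first → f i ≡ 0
    below i i<first = indicator-false (meets? i u) λ meets →
      <⇒≱ i<first (m≤n+o⇒m∸n≤o (suc last) k (≤-trans (meets⇒last<i+k i meets) (≤-reflexive (+-comm i k))))
    above : ∀ i → first + k ≤ i → f i ≡ 0
    above i end≤i = indicator-false (meets? i u) λ meets →
      <⇒≱ (s≤s (meets⇒≤last i meets)) (≤-trans (m≤n+m∸n (suc last) k) (≤-trans (≤-reflexive (+-comm k first)) end≤i))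

  module _ (I : Instance) (wf : WellFormed lam I) (short : ShortWindows I)
           (S : Schedule T lam I) (late : ∀ J → release I J + lam ≤ proj₂ (place S J)) where

    calMeets? : ∀ i c → Dec (Meets i (lookup (cals S) c))
    calMeets? i c = meets? i (lookup (cals S) c)

    meeting : ℕ → List (Fin (length (cals S)))
    meeting i = filter (calMeets? i) (allFin (length (cals S)))

    tasksDue : (i D b n : ℕ) → List Task
    tasksDue i D b n = concatMap (λ e → filter (dueBy? D) (block I i (b + e))) (upTo n)

    length-tasksDue : ∀ i D b n → length (tasksDue i D b n) ≡ released (block I i) D b n
    length-tasksDue i D b n = trans (length-concatMap _ (upTo n)) (sum-map-upTo (λ e → due D (block I i (b + e))) n)

    ∈-tasksDue⁻ : ∀ i D b n {j} → j ∈ tasksDue i D b n →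
      ∃ λ e → b + e < L × dueAt j ≤ D × ∃ λ f → j ≡ task I i (i * L + (b + e) , f)
    ∈-tasksDue⁻ i D b n j∈ =
      let e , _ , j∈e = find (∈-concatMap⁻ (λ e → filter (dueBy? D) (block I i (b + e))) {upTo n} j∈)
          j∈block , d≤D = ∈-filter⁻ (dueBy? D) {xs = block I i (b + e)} j∈e
          b+e<L , f , j≡ = ∈-block⁻ I i (b + e) j∈block
      in e , b+e<L , d≤D , f , j≡

    tasksDue-unique : ∀ i D b n → Unique (tasksDue i D b n)
    tasksDue-unique i D b n = concatMap-unique _
      (λ e → Unique.filter⁺ (dueBy? D) (block-unique I i (b + e))) same-release (Unique.upTo⁺ n)
      where
      released-at : ∀ e {j} → j ∈ filter (dueBy? D) (block I i (b + e)) → proj₁ (proj₂ j) ≡ i * L + (b + e)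
      released-at e j∈ =
        let _ , f , j≡ = ∈-block⁻ I i (b + e) (proj₁ (∈-filter⁻ (dueBy? D) {xs = block I i (b + e)} j∈))
        in cong (λ j → proj₁ (proj₂ j)) j≡
      same-release : ∀ {e e′ j} → j ∈ filter (dueBy? D) (block I i (b + e)) →
                     j ∈ filter (dueBy? D) (block I i (b + e′)) → e ≡ e′
      same-release {e} {e′} j∈ j∈′ =
        +-cancelˡ-≡ b e e′ (+-cancelˡ-≡ (i * L) _ _ (trans (sym (released-at e j∈)) (released-at e′ j∈′)))

    PlacedAt : ℕ → Task → Fin (length (cals S)) × ℕ → Set
    PlacedAt i j p = ∃ λ J → j ≡ task I i J × p ≡ place S J

    PlacedAt-injective : ∀ i {j j′ p} → PlacedAt i j p → PlacedAt i j′ p → j ≡ j′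
    PlacedAt-injective i (J , j≡ , p≡) (J′ , j′≡ , p≡′) =
      trans j≡ (trans (cong (task I i) (inj S (trans (sym p≡) p≡′))) (sym j′≡))

    slots : (i b l : ℕ) → List ℕ
    slots i b l = applyUpTo (firstSlot i + b +_) (suc l)

    ∈-slots⁺ : ∀ i b l {τ} → firstSlot i + b ≤ τ → τ < firstSlot i + (b + suc l) → τ ∈ slots i b l
    ∈-slots⁺ i b l {τ} from to with d , refl ← m≤n⇒∃[o]m+o≡n from = ∈-applyUpTo⁺ (firstSlot i + b +_)
      (+-cancelˡ-< (firstSlot i + b) d (suc l) (<-≤-trans to (≤-reflexive (sym (+-assoc (firstSlot i) b (suc l))))))

    task-fits : ∀ i b l n {j} → j ∈ tasksDue i (b + suc l) b n →
                ∃ λ p → p ∈ cartesianProduct (meeting i) (slots i b l) × PlacedAt i j p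
    task-fits i b l n j∈ with e , b+e<L , d≤D , f , refl ← ∈-tasksDue⁻ i (b + suc l) b n j∈ =
      place S J , ∈-cartesianProduct⁺ meets (∈-slots⁺ i b l from to) , J , refl , refl
      where
      open ≤-Reasoning
      J : Job I
      J = i * L + (b + e) , f
      τ : ℕ
      τ = proj₂ (place S J)
      from : firstSlot i + b ≤ τ
      from = begin
        firstSlot i + b           ≤⟨ +-monoʳ-≤ (firstSlot i) (m≤m+n b e) ⟩
        firstSlot i + (b + e)     ≡⟨ xy∙z≈xz∙y (i * L) lam (b + e) ⟩
        release I J + lam         ≤⟨ late J ⟩
        τ                         ∎
      to : τ < firstSlot i + (b + suc l)
      to = begin-strict
        τ                                          <⟨ dl S J ⟩
        deadline I J                               ≤⟨ m≤n+m∸n (deadline I J) (firstSlot i) ⟩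
        firstSlot i + (deadline I J ∸ firstSlot i) ≤⟨ +-monoʳ-≤ (firstSlot i) d≤D ⟩
        firstSlot i + (b + suc l)                  ∎
      meets : proj₁ (place S J) ∈ meeting i
      meets = ∈-filter⁺ (calMeets? i) (∈-allFin _) (common-slot⇒Meets {i}
        (≤-trans (m≤m+n (firstSlot i) b) from) (<-≤-trans (dl S J) (deadline≤firstSlot+T I wf short i b+e<L f))
        (calLo S J) (calHi S J))

    load≤meeting : ∀ i t b l → load (block I i) t b l ≤ length (meeting i) * suc l
    load≤meeting i t b l = begin
      load (block I i) t b l                               ≡⟨ length-tasksDue i D b n ⟨
      length (tasksDue i D b n)                            ≤⟨ injection⇒length≤ (PlacedAt i) (PlacedAt-injective i)
                                                                (tasksDue-unique i D b n) (task-fits i b l n) ⟩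
      length (cartesianProduct (meeting i) (slots i b l))  ≡⟨ length-cartesianProduct (meeting i) (slots i b l) ⟩
      length (meeting i) * length (slots i b l)            ≡⟨ cong (length (meeting i) *_) (length-applyUpTo (firstSlot i + b +_) (suc l)) ⟩
      length (meeting i) * suc l                           ∎
      where
      open ≤-Reasoning
      D n : ℕ
      D = b + suc l
      n = suc t ∸ b

    density≤meeting : ∀ i t → density (block I i) t ≤ length (meeting i)
    density≤meeting i t = density-least (block I i) t λ b l _ _ → load≤meeting i t b l

    block-cost : ∀ i → ∑[ x < L ] calibs (dec algorithm I (i * L + x)) ≤ 3 * length (meeting i)
    block-cost i = begin
      ∑[ x < L ] calibs (dec algorithm I (i * L + x))   ≡⟨ ∑-cong L (λ x x<L → calibs-block I i x<L) ⟩
      ∑ L (increment count)                             ≡⟨ cong (λ n → ∑ n (increment count)) (suc-pred L) ⟨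
      ∑ (suc (pred L)) (increment count)                ≡⟨ ∑-increment (machineCount-mono (block I i)) (pred L) ⟩
      3 * density (block I i) (pred L)                  ≤⟨ *-monoʳ-≤ 3 (density≤meeting i (pred L)) ⟩
      3 * length (meeting i)                            ∎
      where
      open ≤-Reasoning
      count : ℕ → ℕ
      count = machineCount (block I i)

    ∑-meeting : ∀ k → 2 * T ≤ k * L → ∀ n → ∑[ i < n ] length (meeting i) ≤ length (cals S) * k
    ∑-meeting k 2T≤kL n = begin
      ∑[ i < n ] length (meeting i)             ≤⟨ ∑-length-filter calMeets? n k meets≤k (allFin (length (cals S))) ⟩
      length (allFin (length (cals S))) * k     ≡⟨ cong (_* k) (length-tabulate {n = length (cals S)} id) ⟩
      length (cals S) * k                       ∎
      where
      open ≤-Reasoning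
      meets≤k : ∀ c → ∑[ i < n ] indicator (calMeets? i c) ≤ k
      meets≤k c = meets-count k 2T≤kL n (lookup (cals S) c)

    algCalibs-≤-delayed : ∀ k → 2 * T ≤ k * L → ∀ n → algCalibs algorithm I n ≤ 3 * (length (cals S) * k)
    algCalibs-≤-delayed k 2T≤kL n = begin
      algCalibs algorithm I n                                      ≡⟨ sum-map-upTo (λ t → calibs (dec algorithm I t)) n ⟩
      ∑[ t < n ] calibs (dec algorithm I t)                        ≤⟨ ∑-monoˡ-≤ _ (m≤m*n n L) ⟩
      ∑[ t < n * L ] calibs (dec algorithm I t)                    ≡⟨ ∑-blocks n L _ ⟩
      ∑[ i < n ] ∑[ x < L ] calibs (dec algorithm I (i * L + x))   ≤⟨ ∑-mono-≤ n (λ i _ → block-cost i) ⟩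
      ∑[ i < n ] (3 * length (meeting i))                          ≡⟨ *-distribˡ-∑ 3 n _ ⟨
      3 * ∑[ i < n ] length (meeting i)                            ≤⟨ *-monoʳ-≤ 3 (∑-meeting k 2T≤kL n) ⟩
      3 * (length (cals S) * k)                                    ∎
      where open ≤-Reasoning

  algCalibs-≤ : ∀ I → WellFormed lam I → ShortWindows I → ∀ k → 2 * T ≤ k * L → (S : Schedule T lam I) →
                ∀ n → algCalibs algorithm I n ≤ 3 * (suc lam * k * length (cals S))
  algCalibs-≤ I wf short k 2T≤kL S n = begin
    algCalibs algorithm I n                    ≤⟨ algCalibs-≤-delayed I wf short delayed release+lam≤slot+delay k 2T≤kL n ⟩
    3 * (length (cals delayed) * k)            ≡⟨ cong (λ m → 3 * (m * k)) length-delayed ⟩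
    3 * (length (cals S) * suc lam * k)        ≡⟨ cong (3 *_) (regroup (length (cals S)) (suc lam) k) ⟩
    3 * (suc lam * k * length (cals S))        ∎
    where
    open ≤-Reasoning
    open DelayedSchedule wf S
    regroup : ∀ a b c → a * b * c ≡ b * c * a
    regroup = solve-∀

module BlockLength (k T : ℕ) {{k≢0 : NonZero k}} where

  open Division
  open import Data.Nat
  open import Data.Nat.Properties
  open ≤-Reasoning

  blockLength : ℕ
  blockLength = ⌈ 2 * T / k ⌉

  2T≤k*blockLength : 2 * T ≤ k * blockLength
  2T≤k*blockLength = ≤-trans (m≤⌈m/n⌉*n (2 * T) k) (≤-reflexive (*-comm blockLength k))

  blockLength≢0 : 1 ≤ T → NonZero blockLength
  blockLength≢0 1≤T = m*n≢0⇒n≢0 k {{>-nonZero (<-≤-trans 1≤T (≤-trans (m≤n*m T 2) 2T≤k*blockLength))}}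

  w+blockLength≤T : ∀ w → k * w + 2 * T ≤ k * T → w + blockLength ≤ T
  w+blockLength≤T w slack = begin
    w + blockLength    ≤⟨ +-monoʳ-≤ w (m≤o*n⇒⌈m/n⌉≤o (2 * T) k (T ∸ w) 2T≤[T∸w]*k) ⟩
    w + (T ∸ w)        ≡⟨ m+[n∸m]≡n (*-cancelˡ-≤ k (m+n≤o⇒m≤o (k * w) slack)) ⟩
    T                  ∎
    where
    2T≤[T∸w]*k : 2 * T ≤ (T ∸ w) * k
    2T≤[T∸w]*k = begin
      2 * T                     ≡⟨ m+n∸m≡n (k * w) (2 * T) ⟨
      k * w + 2 * T ∸ k * w     ≤⟨ ∸-monoˡ-≤ (k * w) slack ⟩
      k * T ∸ k * w             ≡⟨ *-distribˡ-∸ k T w ⟨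
      k * (T ∸ w)               ≡⟨ *-comm k (T ∸ w) ⟩
      (T ∸ w) * k               ∎

open import Data.Nat using (ℕ; suc) renaming (_≤_ to _≤ℕ_)
open import Data.Integer using (+_)
open import Data.Rational using (ℚ; _<_; _≤_; _+_; _*_; _/_)
open import Data.Integer as ℤ using (-[1+_]; +[1+_])
open import Data.Integer.DivMod using ([n/d]*d≤n)
import Data.Integer.Properties as ℤ
open import Data.Nat as ℕ using (_!)
import Data.Nat.Properties as ℕ
open import Data.Rational using (mkℚ; 0ℚ; 1ℚ; _-_; -_; _÷_; 1/_; ↥_; ↧_; floor; ceiling; *≤*; *<*; NonNegative; Positive)
open import Data.Rational.Literals using (fromℤ)
open import Data.Rational.Properties
open import Algebra.Properties.Group +-0-group using (//-rightDividesˡ; //-rightDividesʳ)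

ℤ→ℚ≡fromℤ : ∀ z → ℤ→ℚ z ≡ fromℤ z
ℤ→ℚ≡fromℤ z = ↥p/↧p≡p (fromℤ z)

ℕ→ℚ-+ : ∀ m n → ℕ→ℚ (m ℕ.+ n) ≡ ℕ→ℚ m + ℕ→ℚ n
ℕ→ℚ-+ m n rewrite ℤ→ℚ≡fromℤ (+ m) | ℤ→ℚ≡fromℤ (+ n) =
  cong ℤ→ℚ (sym (cong₂ ℤ._+_ (ℤ.*-identityʳ (+ m)) (ℤ.*-identityʳ (+ n))))

ℕ→ℚ-* : ∀ m n → ℕ→ℚ (m ℕ.* n) ≡ ℕ→ℚ m * ℕ→ℚ n
ℕ→ℚ-* m n rewrite ℤ→ℚ≡fromℤ (+ m) | ℤ→ℚ≡fromℤ (+ n) = cong ℤ→ℚ (ℤ.pos-* m n)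

ℕ→ℚ-mono-≤ : ∀ {m n} → m ≤ℕ n → ℕ→ℚ m ≤ ℕ→ℚ n
ℕ→ℚ-mono-≤ {m} {n} m≤n rewrite ℤ→ℚ≡fromℤ (+ m) | ℤ→ℚ≡fromℤ (+ n) =
  *≤* (subst₂ ℤ._≤_ (sym (ℤ.*-identityʳ (+ m))) (sym (ℤ.*-identityʳ (+ n))) (ℤ.+≤+ m≤n))

ℕ→ℚ-cancel-≤ : ∀ {m n} → ℕ→ℚ m ≤ ℕ→ℚ n → m ≤ℕ n
ℕ→ℚ-cancel-≤ {m} {n} m≤n rewrite ℤ→ℚ≡fromℤ (+ m) | ℤ→ℚ≡fromℤ (+ n) =
  ℤ.drop‿+≤+ (subst₂ ℤ._≤_ (ℤ.*-identityʳ (+ m)) (ℤ.*-identityʳ (+ n)) (drop-*≤* m≤n))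

ℕ→ℚ-nonNeg : ∀ n → NonNegative (ℕ→ℚ n)
ℕ→ℚ-nonNeg n = normalize-nonNeg n 1

p≤p+nonNeg : ∀ p q .{{_ : NonNegative q}} → p ≤ p + q
p≤p+nonNeg p q = subst (_≤ p + q) (+-identityʳ p) (+-monoʳ-≤ p (nonNegative⁻¹ q))

floor*↧≤↥ : ∀ p → floor p ℤ.* ↧ p ℤ.≤ ↥ p
floor*↧≤↥ p@record{} = [n/d]*d≤n (↥ p) (↧ p)

≤-ceiling : ∀ p → p ≤ ℤ→ℚ (ceiling p)
≤-ceiling p@record{} rewrite ℤ→ℚ≡fromℤ (ceiling p) = *≤* (begin
  ↥ p ℤ.* + 1                    ≡⟨ ℤ.*-identityʳ (↥ p) ⟩
  ↥ p                            ≡⟨ ℤ.neg-involutive (↥ p) ⟨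
  ℤ.- (ℤ.- ↥ p)                  ≡⟨ cong ℤ.-_ (↥-neg p) ⟨
  ℤ.- (↥ (- p))                  ≤⟨ ℤ.neg-mono-≤ (floor*↧≤↥ (- p)) ⟩
  ℤ.- (floor (- p) ℤ.* ↧ (- p))  ≡⟨ ℤ.neg-distribˡ-* (floor (- p)) (↧ (- p)) ⟩
  ceiling p ℤ.* ↧ (- p)          ≡⟨ cong (ceiling p ℤ.*_) (↧-neg p) ⟩
  ceiling p ℤ.* ↧ p              ∎)
  where open ℤ.≤-Reasoning

0<ℤ→ℚ⇒+[1+] : ∀ z → 0ℚ < ℤ→ℚ z → ∃ λ n → z ≡ +[1+ n ]
0<ℤ→ℚ⇒+[1+] z 0<z rewrite ℤ→ℚ≡fromℤ z with z | 0<z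
... | +[1+ n ] | _ = n , refl
... | + 0      | *<* (ℤ.+<+ ())
... | -[1+ n ] | *<* ()

ceil2div1minus-spec : ∀ α → α < 1ℚ → ∃ λ n → ceil2div1minus α ≡ +[1+ n ] × ℕ→ℚ 2 ≤ ℕ→ℚ (suc n) * (1ℚ - α)
ceil2div1minus-spec α α<1 with 1ℚ - α | subst (_< 1ℚ - α) (+-inverseʳ α) (+-monoˡ-< (- α) α<1)
... | q@(mkℚ +[1+ _ ] _ _) | _ = n , ceil≡ , (begin
  ℕ→ℚ 2                         ≡⟨ *-identityʳ (ℕ→ℚ 2) ⟨
  ℕ→ℚ 2 * 1ℚ                    ≡⟨ cong (ℕ→ℚ 2 *_) (*-inverseˡ q) ⟨
  ℕ→ℚ 2 * (1/ q * q)            ≡⟨ *-assoc (ℕ→ℚ 2) (1/ q) q ⟨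
  ℕ→ℚ 2 ÷ q * q                 ≤⟨ *-monoʳ-≤-nonNeg q (≤-ceiling (ℕ→ℚ 2 ÷ q)) ⟩
  ℤ→ℚ (ceiling (ℕ→ℚ 2 ÷ q)) * q ≡⟨ cong (λ z → ℤ→ℚ z * q) ceil≡ ⟩
  ℕ→ℚ (suc n) * q               ∎)
  where
  open ≤-Reasoning
  instance
    1/q-pos : Positive (1/ q)
    1/q-pos = 1/pos⇒pos q
  ceiling-positive : ∃ λ n → ceiling (ℕ→ℚ 2 ÷ q) ≡ +[1+ n ]
  ceiling-positive = 0<ℤ→ℚ⇒+[1+] _
    (<-≤-trans (positive⁻¹ (ℕ→ℚ 2 ÷ q) {{pos*pos⇒pos (ℕ→ℚ 2) (1/ q)}}) (≤-ceiling (ℕ→ℚ 2 ÷ q)))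
  n : ℕ
  n = proj₁ ceiling-positive
  ceil≡ : ceiling (ℕ→ℚ 2 ÷ q) ≡ +[1+ n ]
  ceil≡ = proj₂ ceiling-positive
... | mkℚ -[1+ _ ] _ _ | *<* ()
... | mkℚ (+ 0) _ _    | *<* (ℤ.+<+ ())

2≤eSum : ∀ n → ℕ→ℚ 2 ≤ eSum (suc n)
2≤eSum ℕ.zero  = ≤-refl
2≤eSum (suc n) = ≤-trans (2≤eSum n)
  (p≤p+nonNeg (eSum (suc n)) _ {{normalize-nonNeg 1 (suc (suc n) !) {{suc (suc n) ℕ.!≢0}}}})

aboveE⇒2≤ : ∀ {q} → AboveE q → ℕ→ℚ 2 ≤ q
aboveE⇒2≤ (n , eUpper≤q) = ≤-trans (≤-trans (2≤eSum n) (p≤p+nonNeg (eSum (suc n)) _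
  {{normalize-nonNeg 1 (suc n ℕ.* suc n !) {{ℕ.m*n≢0 (suc n) (suc n !) {{_}} {{suc n ℕ.!≢0}}}}}})) eUpper≤q

+-cancelʳ-< : ∀ r {p q} → p + r < q + r → p < q
+-cancelʳ-< r {p} {q} p+r<q+r =
  subst₂ _<_ (//-rightDividesʳ r p) (//-rightDividesʳ r q) (+-monoˡ-< (- r) p+r<q+r)

short⇒slack : ∀ α k T w → ℕ→ℚ 2 ≤ ℕ→ℚ k * (1ℚ - α) → ℕ→ℚ w ≤ α * ℕ→ℚ T → k ℕ.* w ℕ.+ 2 ℕ.* T ≤ℕ k ℕ.* T
short⇒slack α k T w 2≤k[1-α] w≤αT = ℕ→ℚ-cancel-≤ (begin
  ℕ→ℚ (k ℕ.* w ℕ.+ 2 ℕ.* T)                         ≡⟨ ℕ→ℚ-+ (k ℕ.* w) (2 ℕ.* T) ⟩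
  ℕ→ℚ (k ℕ.* w) + ℕ→ℚ (2 ℕ.* T)                     ≡⟨ cong₂ _+_ (ℕ→ℚ-* k w) (ℕ→ℚ-* 2 T) ⟩
  ℕ→ℚ k * ℕ→ℚ w + ℕ→ℚ 2 * ℕ→ℚ T                     ≤⟨ +-mono-≤ kw≤kαT 2T≤k[1-α]T ⟩
  ℕ→ℚ k * (α * ℕ→ℚ T) + ℕ→ℚ k * (1ℚ - α) * ℕ→ℚ T    ≡⟨ cong (_+ ℕ→ℚ k * (1ℚ - α) * ℕ→ℚ T) (*-assoc (ℕ→ℚ k) α (ℕ→ℚ T)) ⟨
  ℕ→ℚ k * α * ℕ→ℚ T + ℕ→ℚ k * (1ℚ - α) * ℕ→ℚ T      ≡⟨ *-distribʳ-+ (ℕ→ℚ T) (ℕ→ℚ k * α) (ℕ→ℚ k * (1ℚ - α)) ⟨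
  (ℕ→ℚ k * α + ℕ→ℚ k * (1ℚ - α)) * ℕ→ℚ T            ≡⟨ cong (_* ℕ→ℚ T) (*-distribˡ-+ (ℕ→ℚ k) α (1ℚ - α)) ⟨
  ℕ→ℚ k * (α + (1ℚ - α)) * ℕ→ℚ T                    ≡⟨ cong (λ p → ℕ→ℚ k * p * ℕ→ℚ T) α+[1-α]≡1 ⟩
  ℕ→ℚ k * 1ℚ * ℕ→ℚ T                                ≡⟨ cong (_* ℕ→ℚ T) (*-identityʳ (ℕ→ℚ k)) ⟩
  ℕ→ℚ k * ℕ→ℚ T                                     ≡⟨ ℕ→ℚ-* k T ⟨
  ℕ→ℚ (k ℕ.* T)                                     ∎)
  where
  open ≤-Reasoning
  kw≤kαT : ℕ→ℚ k * ℕ→ℚ w ≤ ℕ→ℚ k * (α * ℕ→ℚ T)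
  kw≤kαT = *-monoˡ-≤-nonNeg (ℕ→ℚ k) {{ℕ→ℚ-nonNeg k}} w≤αT
  2T≤k[1-α]T : ℕ→ℚ 2 * ℕ→ℚ T ≤ ℕ→ℚ k * (1ℚ - α) * ℕ→ℚ T
  2T≤k[1-α]T = *-monoʳ-≤-nonNeg (ℕ→ℚ T) {{ℕ→ℚ-nonNeg T}} 2≤k[1-α]
  α+[1-α]≡1 : α + (1ℚ - α) ≡ 1ℚ
  α+[1-α]≡1 = trans (+-comm α (1ℚ - α)) (//-rightDividesˡ α 1ℚ)

alphaShort⇒shortWindows : ∀ α T lam I k {{_ : NonZero k}} {{_ : NonZero (BlockLength.blockLength k T)}} →
  ℕ→ℚ 2 ≤ ℕ→ℚ k * (1ℚ - α) → WellFormed lam I → AlphaShort α T lam I →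
  BlockAlgorithm.ShortWindows T lam (BlockLength.blockLength k T) I
alphaShort⇒shortWindows α T lam I k 2≤k[1-α] wf short j = begin
  deadline I j ℕ.+ blockLength             ≡⟨ cong (ℕ._+ blockLength) deadline≡ ⟨
  r ℕ.+ lam ℕ.+ w ℕ.+ blockLength          ≡⟨ ℕ.+-assoc (r ℕ.+ lam) w blockLength ⟩
  r ℕ.+ lam ℕ.+ (w ℕ.+ blockLength)        ≤⟨ ℕ.+-monoʳ-≤ (r ℕ.+ lam) (w+blockLength≤T w slack) ⟩
  r ℕ.+ lam ℕ.+ T                          ∎
  where
  open BlockLength k T
  open ℕ.≤-Reasoning
  r w : ℕ
  r = release I j
  w = deadline I j ℕ.∸ (r ℕ.+ lam)
  deadline≡ : r ℕ.+ lam ℕ.+ w ≡ deadline I j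
  deadline≡ = ℕ.m+[n∸m]≡n (ℕ.≤-trans (ℕ.+-monoʳ-≤ r (ℕ.n≤1+n lam)) (wf j))
  window≡ : deadline I j ℕ.∸ r ≡ w ℕ.+ lam
  window≡ = trans (cong (ℕ._∸ r) (sym (trans (regroup r w lam) deadline≡))) (ℕ.m+n∸m≡n r (w ℕ.+ lam))
    where
    regroup : ∀ r w l → r ℕ.+ (w ℕ.+ l) ≡ r ℕ.+ l ℕ.+ w
    regroup = solve-∀
  w<αT : ℕ→ℚ w < α * ℕ→ℚ T
  w<αT = +-cancelʳ-< (ℕ→ℚ lam)
    (subst (_< α * ℕ→ℚ T + ℕ→ℚ lam) (trans (cong ℕ→ℚ window≡) (ℕ→ℚ-+ w lam)) (short j))
  slack : k ℕ.* w ℕ.+ 2 ℕ.* T ≤ℕ k ℕ.* T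
  slack = short⇒slack α k T w 2≤k[1-α] (<⇒≤ w<αT)

≤3abn⇒≤[q+1]abn : ∀ {q} → ℕ→ℚ 2 ≤ q → ∀ {m} a b n → m ≤ℕ 3 ℕ.* (a ℕ.* b ℕ.* n) →
                  ℕ→ℚ m ≤ (q + 1ℚ) * ℕ→ℚ a * ℕ→ℚ b * ℕ→ℚ n + ℕ→ℚ 0
≤3abn⇒≤[q+1]abn {q} 2≤q {m} a b n m≤3abn = begin
  ℕ→ℚ m                                         ≤⟨ ℕ→ℚ-mono-≤ m≤3abn ⟩
  ℕ→ℚ (3 ℕ.* (a ℕ.* b ℕ.* n))                   ≡⟨ cong ℕ→ℚ (regroup a b n) ⟩
  ℕ→ℚ (3 ℕ.* a ℕ.* b ℕ.* n)                     ≡⟨ ℕ→ℚ-* (3 ℕ.* a ℕ.* b) n ⟩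
  ℕ→ℚ (3 ℕ.* a ℕ.* b) * ℕ→ℚ n                   ≡⟨ cong (_* ℕ→ℚ n) (ℕ→ℚ-* (3 ℕ.* a) b) ⟩
  ℕ→ℚ (3 ℕ.* a) * ℕ→ℚ b * ℕ→ℚ n                 ≡⟨ cong (λ p → p * ℕ→ℚ b * ℕ→ℚ n) (ℕ→ℚ-* 3 a) ⟩
  ℕ→ℚ 3 * ℕ→ℚ a * ℕ→ℚ b * ℕ→ℚ n                 ≤⟨ scale n (scale b (scale a (+-monoˡ-≤ 1ℚ 2≤q))) ⟩
  (q + 1ℚ) * ℕ→ℚ a * ℕ→ℚ b * ℕ→ℚ n              ≡⟨ +-identityʳ _ ⟨
  (q + 1ℚ) * ℕ→ℚ a * ℕ→ℚ b * ℕ→ℚ n + ℕ→ℚ 0      ∎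
  where
  open ≤-Reasoning
  scale : ∀ m {p p′} → p ≤ p′ → p * ℕ→ℚ m ≤ p′ * ℕ→ℚ m
  scale m = *-monoʳ-≤-nonNeg (ℕ→ℚ m) {{ℕ→ℚ-nonNeg m}}
  regroup : ∀ a b n → 3 ℕ.* (a ℕ.* b ℕ.* n) ≡ 3 ℕ.* a ℕ.* b ℕ.* n
  regroup = solve-∀

theorem2 : (α : ℚ) → (+ 0 / 1) < α → α < (+ 1 / 1) →
    (lam : ℕ) → (T : ℕ) → 1 ≤ℕ T →
    Σ OnlineAlg λ A → Σ ℕ λ a →
      ∀ (I : Instance) → WellFormed lam I → AlphaShort α T lam I →
        Feasible T lam A I
        × (∀ (S : Schedule T lam I) (q : ℚ) → AboveE q → (N : ℕ) →
             ℕ→ℚ (algCalibs A I N)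
               ≤ (q + (+ 1 / 1)) * ℕ→ℚ (suc lam) * ℤ→ℚ (ceil2div1minus α)
                   * ℕ→ℚ (length (cals S)) + ℕ→ℚ a)
theorem2 α _ α<1 lam T 1≤T with ceil2div1minus α | ceil2div1minus-spec α α<1
... | .(+[1+ n ]) | n , refl , 2≤k[1-α] = algorithm , 0 , λ I wf short →
  let windows = alphaShort⇒shortWindows α T lam I k 2≤k[1-α] wf short in
  feasible I wf windows ,
  λ S q e<q N → ≤3abn⇒≤[q+1]abn (aboveE⇒2≤ e<q) (suc lam) k (length (cals S))
    (algCalibs-≤ I wf windows k 2T≤k*blockLength S N)
  where
  k : ℕ
  k = suc n
  open BlockLength k T
  instance
    L≢0 : NonZero blockLength
    L≢0 = blockLength≢0 1≤T
  open BlockAlgorithm T lam blockLength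
  open OfflineBound T lam blockLength
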